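{- Let $q$ be a prime power and let $\lambda=(k,k-1,\dots,2,1)$ be a staircase, $k\geq 1$. Then, under a uniformly random ring homomorphism $\Lambda\to\mathbb{F}_q$, $P(s_\lambda\mapsto 0)=1/q$.
   Context: $\Lambda$ is the ring of symmetric functions over $\mathbb{Z}$, $h_k$ the complete homogeneous symmetric functions, $s_\lambda$ the Schur functions. A uniformly random ring homomorphism $\Lambda\to\mathbb{F}_q$ is obtained by sending $h_1,h_2,\dots$ to independent uniformly random elements of $\mathbb{F}_q$. -}

module Defs where

open import Level using (Level; _⊔_)
open import Data.Nat as ℕ using (ℕ; zero; suc; _^_; _≤_; _<?_)
open import Data.Nat.Primality using (Prime)
open import Data.Integer as ℤ using (ℤ; +_; -[1+_])
open import Data.Fin using (Fin; zero; suc; toℕ)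
open import Data.List using (List; []; _∷_; length; filter; map; concatMap; allFin; lookup)
open import Data.Product using (Σ; ∃; _×_; _,_)
open import Relation.Binary.PropositionalEquality using (_≡_)
open import Relation.Nullary using (¬_; Dec; yes; no)
open import Relation.Unary using (Decidable)
open import Algebra.Bundles using (CommutativeRing)

IsPrimePower : ℕ → Set
IsPrimePower q = Σ ℕ λ p → Σ ℕ λ e → Prime p × (1 ≤ e) × (q ≡ p ^ e)

module _ {c ℓ : Level} (R : CommutativeRing c ℓ) where
  open CommutativeRing R using (Carrier; _+_; _*_; -_; 0#; 1#)

  sgn : ℕ → Carrier → Carrier
  sgn zero    x = x
  sgn (suc i) x = - sgn i x

  skip : {n : ℕ} → Fin (suc n) → Fin n → Fin (suc n)
  skip zero    i       = suc i
  skip (suc j) zero    = zero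
  skip (suc j) (suc i) = suc (skip j i)

  det : (n : ℕ) → (Fin n → Fin n → Carrier) → Carrier
  det zero    M = 1#
  det (suc n) M = sumFin (λ j → sgn (toℕ j) (M zero j * det n (λ a b → M (suc a) (skip j b))))
    where
    sumFin : {m : ℕ} → (Fin m → Carrier) → Carrier
    sumFin {zero}  f = 0#
    sumFin {suc m} f = f zero + sumFin (λ i → f (suc i))

  -- image of h_r under a ring map sending h_{n+1} ↦ x n, with h_0 = 1, h_r = 0 for r < 0
  hImg : (ℕ → Carrier) → ℤ → Carrier
  hImg x -[1+ _ ]     = 0#
  hImg x (+ zero)     = 1#
  hImg x (+ (suc n))  = x n

  -- image of the Schur function s_λ (λ given as its list of parts λ₁ ≥ λ₂ ≥ … )
  -- under the ring map h_{n+1} ↦ x n, via Jacobi–Trudi: s_λ = det (h_{λᵢ - i + j})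
  schurImg : List ℕ → (ℕ → Carrier) → Carrier
  schurImg λs x = det (length λs)
    (λ i j → hImg x ((+ lookup λs i) ℤ.- (+ toℕ i) ℤ.+ (+ toℕ j)))

staircase : ℕ → List ℕ
staircase zero    = []
staircase (suc k) = suc k ∷ staircase k

record FiniteField (c ℓ : Level) (q : ℕ) : Set (Level.suc (c ⊔ ℓ)) where
  field
    ring     : CommutativeRing c ℓ
  open CommutativeRing ring using (Carrier; _≈_; _*_; 0#; 1#)
  field
    1≉0      : ¬ (1# ≈ 0#)
    inverse  : ∀ x → ¬ (x ≈ 0#) → ∃ λ y → (x * y) ≈ 1#
    _≈?_     : ∀ x y → Dec (x ≈ y)
    enum     : Fin q → Carrier
    enum-inj : ∀ i j → enum i ≈ enum j → i ≡ j
    enum-sur : ∀ x → ∃ λ i → enum i ≈ x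

allTuples : (q N : ℕ) → List (Fin N → Fin q)
allTuples q zero    = (λ ()) ∷ []
allTuples q (suc N) =
  concatMap (λ a → map (λ t → λ { zero → a ; (suc i) → t i }) (allTuples q N)) (allFin q)

module _ {c ℓ : Level} {q : ℕ} (F : FiniteField c ℓ q) where
  open FiniteField F
  open CommutativeRing ring using (Carrier; 0#)

  -- the ring map determined by the values t of h_1, …, h_N (higher h's ↦ 0)
  assign : (N : ℕ) → (Fin N → Fin q) → ℕ → Carrier
  assign N t n with n <? N
  ... | yes n<N = enum (t (Data.Fin.fromℕ< n<N))
  ... | no  _   = 0#

  zeroCount : List ℕ → (N : ℕ) → ℕ
  zeroCount λs N = length (filter (λ t → schurImg ring λs (assign N t) ≈? 0#) (allTuples q N))

{-# OPTIONS --safe #-}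
module Submission where

open import Defs
open import Level using (Level)
open import Algebra.Bundles using (CommutativeMonoid; CommutativeRing)
open import Data.Bool using (if_then_else_)
open import Data.Fin as Fin using (Fin; zero; suc; toℕ; fromℕ<; inject₁; opposite; punchIn; punchOut)
import Data.Fin.Permutation as Perm
import Data.Fin.Properties as Fin
open import Data.Integer as ℤ using (+_; -[1+_]; _⊖_)
import Data.Integer.Properties as ℤ
open import Data.List as List using (List; []; _∷_; length; filter; concatMap; tabulate; lookup)
open import Data.List.Properties using (filter-++; length-++)
open import Data.Nat as ℕ using (ℕ; zero; suc; _^_; _≤_; ⌊_/2⌋; ⌈_/2⌉)
import Data.Nat.Properties as ℕ
open import Data.Product using (∃; _×_; _,_; proj₁; proj₂)
open import Data.Sum using (_⊎_; inj₁; inj₂; [_,_]′)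
open import Data.Vec.Functional using (insertAt)
open import Data.Vec.Functional.Properties using (insertAt-lookup; insertAt-punchIn)
open import Function using (_∘_; id)
open import Function.Bundles using (_⇔_; mk⇔; Equivalence)
open import Function.Properties.Equivalence using () renaming (trans to ⇔-trans; sym to ⇔-sym)
open import Relation.Binary using (tri<; tri≈; tri>)
open import Relation.Binary.PropositionalEquality as ≡ using (_≡_; _≢_)
open import Relation.Nullary using (¬_; Dec; yes; no; does; contradiction)
import Relation.Nullary.Decidable as Dec
import Algebra.Properties.Semiring.Sum ℕ.+-*-semiring as ℕΣ

-- By Jacobi–Trudi the matrix of the staircase is (h_{k-2i+j}), so it is singular
-- iff some nonzero polynomial U of degree < k makes the coefficients of
-- t, t³, …, t^{2k-1} in U(t) H(t) vanish.  Splitting into even and odd parts,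
-- this says that α p + β c ≡ 0 mod s^k for a nonzero pair of polynomials α, β
-- with ⌈k/2⌉ and ⌊k/2⌋ coefficients, where p_i = h_{2i+1} and c_i = h_{2i}.
-- One step of the Euclidean algorithm on (p , c) lowers k by one, and for fixed
-- h₁ it is a bijective linear change of the remaining variables.  Hence for
-- every value of h₁ the proportion 1/q is inherited from a smaller problem,
-- until β has no coefficients left and the condition reads h₁ = 0.

-- The obstacle is the length of the polynomials. Eliminating with pivot c₀ replaces β by (p₀ α + c₀
-- β)/s, which is sure to be one coefficient shorter than β only if α is no longer than β, or if p₀
-- = 0. If α is longer and p₀ ≠ 0, the two series trade places and p₀ becomes the pivot. If p₀ = 0,
-- then β shrinks while α keeps its length, so the lengths may drift apart; and after a trade the
-- pivot need not be 1. The induction therefore covers all lengths a ≥ 1 and b with a + b = m, and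
-- every nonzero constant term h₀. The branch depends only on the lengths and on p₀. Once p₀ is
-- fixed, the elimination is a single linear map applied to each pair of next coefficients of c and
-- p: a shear up to scaling by the pivot, hence a bijection of the plane. The same algorithm also
-- decides whether a kernel pair exists, and this decision is what gets counted at the intermediate
-- stages.

module SingleTerm {c ℓ : Level} (A : CommutativeMonoid c ℓ) where
  open CommutativeMonoid A
  open import Algebra.Properties.CommutativeMonoid.Sum A

  sum-0 : ∀ {n} {f : Fin n → Carrier} → (∀ i → f i ≈ ε) → sum f ≈ ε
  sum-0 {n} e = trans (sum-cong-≋ e) (sum-replicate-zero n)

  sum-single : ∀ {n} {f : Fin n → Carrier} (l : Fin n) → (∀ i → i ≢ l → f i ≈ ε) → sum f ≈ f l
  sum-single {suc n} {f} l e = trans (sum-remove f)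
    (trans (∙-congˡ (sum-0 (λ i → e (punchIn l i) (Fin.punchInᵢ≢i l i)))) (identityʳ _))

-- Determinants

module Determinant {c ℓ : Level} (R : CommutativeRing c ℓ) where
  open CommutativeRing R hiding (zero)
  open import Algebra.Properties.Ring ring using (-‿distribˡ-*)
  open import Algebra.Properties.Semiring.Sum semiring
  open SingleTerm +-commutativeMonoid
  open import Algebra.Properties.CommutativeSemigroup *-commutativeSemigroup using (x∙yz≈y∙xz)
  open import Algebra.Solver.Ring.NaturalCoefficients.Default commutativeSemiring
    using (solve; _:=_; _:*_)
  open import Relation.Binary.Reasoning.Setoid setoid

  Mat : ℕ → Set c
  Mat n = Fin n → Fin n → Carrier

  minor : ∀ {n} → Mat (suc n) → Fin (suc n) → Mat n
  minor M j a b = M (suc a) (skip R j b)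

  term : ∀ {n} → Mat (suc n) → Fin (suc n) → Carrier
  term {n} M j = sgn R (toℕ j) (M zero j * det R n (minor M j))

  -- The summation inside det is a local function that cannot be named from
  -- here; unification recovers it as the value of the metavariable in detSum.
  mutual
    detSum : (n : ℕ) → Mat (suc n) → (m : ℕ) → (Fin m → Carrier) → Carrier
    detSum = λ n M m f → _

    detSum-solution : ∀ m (M : Mat (suc (suc m))) →
      det R (suc (suc m)) M ≡
        term M zero + (term M (suc zero) + detSum (suc m) M m (λ i → term M (suc (suc i))))
    detSum-solution m M with term M zero | term M (suc zero) | (λ i → term M (suc (suc i)))
    ... | a | b | f with suc m
    ...   | n = ≡.refl

    detSum≡sum : ∀ n M m f → detSum n M m f ≡ sum f
    detSum≡sum n M zero    f = ≡.refl
    detSum≡sum n M (suc m) f = ≡.cong (λ s → f zero + s) (detSum≡sum n M m (f ∘ suc))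

  det-expand : ∀ {n} (M : Mat (suc n)) → det R (suc n) M ≡ sum (term M)
  det-expand {n} M = detSum≡sum n M (suc n) (term M)

  sgn-* : ∀ i x → sgn R i x ≈ sgn R i 1# * x
  sgn-* zero    x = sym (*-identityˡ x)
  sgn-* (suc i) x = trans (-‿cong (sgn-* i x)) (-‿distribˡ-* _ x)

  sgn-cong : ∀ i {x y} → x ≈ y → sgn R i x ≈ sgn R i y
  sgn-cong zero    e = e
  sgn-cong (suc i) e = -‿cong (sgn-cong i e)

  sgn-0 : ∀ i {x} → x ≈ 0# → sgn R i x ≈ 0#
  sgn-0 i e = trans (sgn-* i _) (trans (*-congˡ e) (zeroʳ _))

  skip≡punchIn : ∀ {n} (j : Fin (suc n)) (b : Fin n) → skip R j b ≡ punchIn j b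
  skip≡punchIn zero    b       = ≡.refl
  skip≡punchIn (suc j) zero    = ≡.refl
  skip≡punchIn (suc j) (suc b) = ≡.cong suc (skip≡punchIn j b)

  sum-scale : ∀ {K} x (v y : Fin K → Carrier) →
    x * sum (λ k → v k * y k) ≈ sum (λ k → v k * (x * y k))
  sum-scale x v y = trans (*-distribˡ-sum x (λ k → v k * y k)) (sum-cong-≋ λ k → x∙yz≈y∙xz x (v k) (y k))

  det-cong : ∀ {n} {M N : Mat n} → (∀ i j → M i j ≈ N i j) → det R n M ≈ det R n N
  det-cong {zero}  e = refl
  det-cong {suc n} {M} {N} e = begin
    det R (suc n) M ≡⟨ det-expand M ⟩
    sum (term M)    ≈⟨ sum-cong-≋ (λ j → sgn-cong (toℕ j) (*-cong (e zero j)
                         (det-cong (λ a b → e (suc a) (skip R j b))))) ⟩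
    sum (term N)    ≡⟨ det-expand N ⟨
    det R (suc n) N ∎

  -- In the expansion along the first row, column l enters the term j = l through the entry and
  -- every other term through the minor, where induction applies. Arbitrary K covers three uses: K =
  -- 0 is a zero column, K = 2 is additivity, K = n is Cramer's rule.
  det-linear : ∀ {n K} (l : Fin n) (v : Fin K → Carrier) (N : Fin K → Mat n) (P : Mat n) →
    (∀ k i j → j ≢ l → N k i j ≈ P i j) →
    (∀ i → P i l ≈ sum (λ k → v k * N k i l)) →
    det R n P ≈ sum (λ k → v k * det R n (N k))
  det-linear {suc n} {K} l v N P off at = begin
    det R (suc n) P                           ≡⟨ det-expand P ⟩
    sum (term P)                              ≈⟨ sum-cong-≋ step ⟩
    sum (λ j → sum (λ k → v k * term (N k) j)) ≈⟨ ∑-comm (λ j k → v k * term (N k) j) ⟩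
    sum (λ k → sum (λ j → v k * term (N k) j)) ≈⟨ sum-cong-≋ (λ k → *-distribˡ-sum (v k) (term (N k))) ⟨
    sum (λ k → v k * sum (term (N k)))        ≈⟨ sum-cong-≋ (λ k → *-congˡ (reflexive (≡.sym (det-expand (N k))))) ⟩
    sum (λ k → v k * det R (suc n) (N k))     ∎
    where
    step : ∀ j → term P j ≈ sum (λ k → v k * term (N k) j)
    step j with j Fin.≟ l
    ... | yes ≡.refl = begin
      term P j                                  ≈⟨ sgn-* (toℕ j) _ ⟩
      s * (P zero j * d)                        ≈⟨ *-congˡ (*-congʳ (at zero)) ⟩
      s * (sum (λ k → v k * N k zero j) * d)    ≈⟨ solve 3 (λ s x d → s :* (x :* d) := (s :* d) :* x) refl s _ d ⟩
      (s * d) * sum (λ k → v k * N k zero j)    ≈⟨ sum-scale (s * d) v _ ⟩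
      sum (λ k → v k * ((s * d) * N k zero j))  ≈⟨ sum-cong-≋ (λ k → *-congˡ (begin
        (s * d) * N k zero j ≈⟨ solve 3 (λ s x d → (s :* d) :* x := s :* (x :* d)) refl s (N k zero j) d ⟩
        s * (N k zero j * d) ≈⟨ *-congˡ (*-congˡ (det-cong (λ a b → sym (off k (suc a) (skip R j b)
                                  (λ q → Fin.punchInᵢ≢i j b (≡.trans (≡.sym (skip≡punchIn j b)) q)))))) ⟩
        s * (N k zero j * det R n (minor (N k) j)) ≈⟨ sgn-* (toℕ j) _ ⟨
        term (N k) j ∎)) ⟩
      sum (λ k → v k * term (N k) j)            ∎
      where s = sgn R (toℕ j) 1#
            d = det R n (minor P j)
    ... | no j≢l = begin
      term P j                                           ≈⟨ sgn-* (toℕ j) _ ⟩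
      s * (P zero j * det R n (minor P j))               ≈⟨ *-congˡ (*-congˡ minor-linear) ⟩
      s * (P zero j * sum (λ k → v k * D k))             ≈⟨ *-assoc s _ _ ⟨
      (s * P zero j) * sum (λ k → v k * D k)             ≈⟨ sum-scale (s * P zero j) v D ⟩
      sum (λ k → v k * ((s * P zero j) * D k))           ≈⟨ sum-cong-≋ (λ k → *-congˡ (begin
        (s * P zero j) * D k   ≈⟨ *-assoc s _ _ ⟩
        s * (P zero j * D k)   ≈⟨ *-congˡ (*-congʳ (off k zero j j≢l)) ⟨
        s * (N k zero j * D k) ≈⟨ sgn-* (toℕ j) _ ⟨
        term (N k) j           ∎)) ⟩
      sum (λ k → v k * term (N k) j)                     ∎
      where s = sgn R (toℕ j) 1#
            l′ = punchOut j≢l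
            D = λ k → det R n (minor (N k) j)
            l-eq : skip R j l′ ≡ l
            l-eq = ≡.trans (skip≡punchIn j l′) (Fin.punchIn-punchOut j≢l)
            skip≢l : ∀ b → b ≢ l′ → skip R j b ≢ l
            skip≢l b b≢l′ h = b≢l′ (Fin.punchIn-injective j b l′
              (≡.trans (≡.sym (skip≡punchIn j b)) (≡.trans h (≡.sym (Fin.punchIn-punchOut j≢l)))))
            minor-linear : det R n (minor P j) ≈ sum (λ k → v k * D k)
            minor-linear = det-linear l′ v (λ k → minor (N k) j) (minor P j)
              (λ k a b b≢l′ → off k (suc a) (skip R j b) (skip≢l b b≢l′))
              (λ a → ≡.subst (λ t → P (suc a) t ≈ sum (λ k → v k * N k (suc a) t)) (≡.sym l-eq) (at (suc a)))

  -- Deleting one or the other of two neighbouring columns leaves the same list, except that the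
  -- survivor of the pair differs. If the two columns are equal, so are the minors.
  skip-adjacent : ∀ {n} (p b : Fin n) →
    skip R (inject₁ p) b ≡ skip R (suc p) b ⊎
    (skip R (inject₁ p) b ≡ suc p × skip R (suc p) b ≡ inject₁ p)
  skip-adjacent zero    zero    = inj₂ (≡.refl , ≡.refl)
  skip-adjacent zero    (suc b) = inj₁ ≡.refl
  skip-adjacent (suc p) zero    = inj₁ ≡.refl
  skip-adjacent (suc p) (suc b) with skip-adjacent p b
  ... | inj₁ e       = inj₁ (≡.cong suc e)
  ... | inj₂ (e , f) = inj₂ (≡.cong suc e , ≡.cong suc f)

  skip-over-adjacent : ∀ {n} (j : Fin (suc (suc n))) (p : Fin (suc n)) → j ≢ inject₁ p → j ≢ suc p →
    ∃ λ (p′ : Fin n) → skip R j (inject₁ p′) ≡ inject₁ p × skip R j (suc p′) ≡ suc p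
  skip-over-adjacent zero    zero    ne nf = contradiction ≡.refl ne
  skip-over-adjacent zero    (suc p) ne nf = p , ≡.refl , ≡.refl
  skip-over-adjacent (suc zero) zero ne nf = contradiction ≡.refl nf
  skip-over-adjacent {suc n} (suc (suc j)) zero ne nf = zero , ≡.refl , ≡.refl
  skip-over-adjacent {suc n} (suc j) (suc p) ne nf
    with skip-over-adjacent j p (ne ∘ ≡.cong suc) (nf ∘ ≡.cong suc)
  ... | p′ , e , f = suc p′ , ≡.cong suc e , ≡.cong suc f

  sum-adjacent : ∀ {n} (p : Fin n) (f : Fin (suc n) → Carrier) →
    (∀ j → j ≢ inject₁ p → j ≢ suc p → f j ≈ 0#) → f (inject₁ p) + f (suc p) ≈ 0# → sum f ≈ 0#
  sum-adjacent zero f off e = begin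
    f zero + (f (suc zero) + sum (λ i → f (suc (suc i)))) ≈⟨ +-assoc _ _ _ ⟨
    (f zero + f (suc zero)) + sum (λ i → f (suc (suc i))) ≈⟨ +-cong e (sum-0 (λ i → off (suc (suc i)) (λ ()) (λ ()))) ⟩
    0# + 0#                                              ≈⟨ +-identityˡ 0# ⟩
    0#                                                   ∎
  sum-adjacent (suc p) f off e = begin
    f zero + sum (f ∘ suc) ≈⟨ +-cong (off zero (λ ()) (λ ()))
                                (sum-adjacent p (f ∘ suc)
                                  (λ j ne nf → off (suc j) (ne ∘ Fin.suc-injective) (nf ∘ Fin.suc-injective)) e) ⟩
    0# + 0#                ≈⟨ +-identityˡ 0# ⟩
    0#                     ∎

  -- Minors that keep both columns vanish by induction. The two remaining terms have equal entries
  -- and equal minors but opposite signs.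
  det-adjacent : ∀ {n} (p : Fin n) (M : Mat (suc n)) → (∀ i → M i (inject₁ p) ≈ M i (suc p)) →
    det R (suc n) M ≈ 0#
  det-adjacent {suc n} p M e = trans (reflexive (det-expand M)) (sum-adjacent p (term M) off at)
    where
    off : ∀ j → j ≢ inject₁ p → j ≢ suc p → term M j ≈ 0#
    off j ne nf with skip-over-adjacent j p ne nf
    ... | p′ , f , g = sgn-0 (toℕ j) (trans (*-congˡ (det-adjacent p′ (minor M j) (λ i → begin
      M (suc i) (skip R j (inject₁ p′)) ≡⟨ ≡.cong (M (suc i)) f ⟩
      M (suc i) (inject₁ p)             ≈⟨ e (suc i) ⟩
      M (suc i) (suc p)                 ≡⟨ ≡.cong (M (suc i)) g ⟨
      M (suc i) (skip R j (suc p′))     ∎))) (zeroʳ _))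
    minors : ∀ a b → minor M (inject₁ p) a b ≈ minor M (suc p) a b
    minors a b with skip-adjacent p b
    ... | inj₁ f       = reflexive (≡.cong (M (suc a)) f)
    ... | inj₂ (f , g) = begin
      M (suc a) (skip R (inject₁ p) b) ≡⟨ ≡.cong (M (suc a)) f ⟩
      M (suc a) (suc p)                ≈⟨ e (suc a) ⟨
      M (suc a) (inject₁ p)            ≡⟨ ≡.cong (M (suc a)) g ⟨
      M (suc a) (skip R (suc p) b)     ∎
    at : term M (inject₁ p) + term M (suc p) ≈ 0#
    at = trans (+-congʳ (trans
           (reflexive (≡.cong (λ i → sgn R i (M zero (inject₁ p) * det R (suc n) (minor M (inject₁ p))))
             (Fin.toℕ-inject₁ p)))
           (sgn-cong (toℕ p) (*-cong (e zero) (det-cong minors))))) (-‿inverseʳ _)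

  setCol : ∀ {n} → Mat n → Fin n → (Fin n → Carrier) → Mat n
  setCol M l w i j with j Fin.≟ l
  ... | yes _ = w i
  ... | no _  = M i j

  setCol-at : ∀ {n} (M : Mat n) l w i → setCol M l w i l ≡ w i
  setCol-at M l w i with l Fin.≟ l
  ... | yes _ = ≡.refl
  ... | no ne = contradiction ≡.refl ne

  setCol-off : ∀ {n} (M : Mat n) l w i j → j ≢ l → setCol M l w i j ≡ M i j
  setCol-off M l w i j ne with j Fin.≟ l
  ... | yes e = contradiction e ne
  ... | no _  = ≡.refl

  det-setCol-+ : ∀ {n} (M : Mat n) l u w →
    det R n (setCol M l (λ i → u i + w i)) ≈ det R n (setCol M l u) + det R n (setCol M l w)
  det-setCol-+ {n} M l u w = begin
    det R n (setCol M l (λ i → u i + w i))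
      ≈⟨ det-linear l (λ _ → 1#) N (setCol M l (λ i → u i + w i)) off at ⟩
    1# * det R n (setCol M l u) + (1# * det R n (setCol M l w) + 0#)
      ≈⟨ simp _ _ ⟩
    det R n (setCol M l u) + det R n (setCol M l w) ∎
    where
    simp : ∀ x y → 1# * x + (1# * y + 0#) ≈ x + y
    simp x y = +-cong (*-identityˡ x) (trans (+-identityʳ _) (*-identityˡ y))
    N : Fin 2 → Mat n
    N zero    = setCol M l u
    N (suc _) = setCol M l w
    off : ∀ k i j → j ≢ l → N k i j ≈ setCol M l (λ i → u i + w i) i j
    off zero    i j ne = reflexive (≡.trans (setCol-off M l _ i j ne) (≡.sym (setCol-off M l _ i j ne)))
    off (suc k) i j ne = reflexive (≡.trans (setCol-off M l _ i j ne) (≡.sym (setCol-off M l _ i j ne)))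
    at : ∀ i → setCol M l (λ i → u i + w i) i l ≈ sum (λ k → 1# * N k i l)
    at i = begin
      setCol M l (λ i → u i + w i) i l ≡⟨ setCol-at M l _ i ⟩
      u i + w i                        ≡⟨ ≡.cong₂ _+_ (setCol-at M l u i) (setCol-at M l w i) ⟨
      N zero i l + N (suc zero) i l    ≈⟨ simp _ _ ⟨
      sum (λ k → 1# * N k i l)         ∎

  det-setCol-self : ∀ {n} (M : Mat n) l → det R n (setCol M l (λ i → M i l)) ≈ det R n M
  det-setCol-self M l = det-cong eq
    where
    eq : ∀ i j → setCol M l (λ i → M i l) i j ≈ M i j
    eq i j with j Fin.≟ l
    ... | yes ≡.refl = refl
    ... | no _       = refl

  setCol-comm : ∀ {n} (M : Mat n) {l m} → l ≢ m → ∀ u w i j →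
    setCol (setCol M l u) m w i j ≡ setCol (setCol M m w) l u i j
  setCol-comm M {l} {m} l≢m u w i j = by-cases (j Fin.≟ l) (j Fin.≟ m)
    where
    by-cases : Dec (j ≡ l) → Dec (j ≡ m) →
      setCol (setCol M l u) m w i j ≡ setCol (setCol M m w) l u i j
    by-cases (yes ≡.refl) _ = ≡.trans (setCol-off (setCol M l u) m w i j l≢m)
      (≡.trans (setCol-at M l u i) (≡.sym (setCol-at (setCol M m w) l u i)))
    by-cases (no f) (yes ≡.refl) = ≡.trans (setCol-at (setCol M l u) m w i)
      (≡.sym (≡.trans (setCol-off (setCol M m w) l u i j f) (setCol-at M m w i)))
    by-cases (no f) (no e) = ≡.trans (setCol-off (setCol M l u) m w i j e)
      (≡.trans (setCol-off M l u i j f)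
        (≡.sym (≡.trans (setCol-off (setCol M m w) l u i j f) (setCol-off M m w i j e))))

  -- Expanding the vanishing determinant with x + y in the adjacent columns m and
  -- suc r moves the repeated column x one position closer to p.
  det-equal-cols-≤ : ∀ g {n} (M : Mat (suc n)) (r : Fin n) (p : Fin (suc n)) → toℕ r ℕ.≤ g → toℕ p ℕ.≤ toℕ r →
    (∀ i → M i p ≈ M i (suc r)) → det R (suc n) M ≈ 0#
  det-equal-cols-≤ g M r p r≤g p≤r e with p Fin.≟ inject₁ r
  ... | yes ≡.refl = det-adjacent r M e
  det-equal-cols-≤ g M zero zero r≤g p≤r e | no ne = contradiction ≡.refl ne
  det-equal-cols-≤ (suc g) {suc n} M (suc r) p (ℕ.s≤s r≤g) p≤r e | no p≢m = begin
    d M                                     ≈⟨ det-cong restore ⟨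
    d (B y x)                               ≈⟨ +-identityʳ _ ⟨
    d (B y x) + 0#                          ≈⟨ +-congˡ (+-identityˡ 0#) ⟨
    d (B y x) + (0# + 0#)                   ≈⟨ +-cong (+-identityˡ _) (+-cong zero-xy (adj y)) ⟨
    (0# + d (B y x)) + (d (B x y) + d (B y y)) ≈⟨ +-congʳ (+-congʳ (adj x)) ⟨
    (d (B x x) + d (B y x)) + (d (B x y) + d (B y y)) ≈⟨ +-cong (split x) (split y) ⟨
    d (B xy x) + d (B xy y)                 ≈⟨ det-setCol-+ (setCol M m xy) q x y ⟨
    d (B xy xy)                             ≈⟨ adj xy ⟩
    0#                                      ∎
    where
    d = det R (suc (suc n))
    q m : Fin (suc (suc n))
    q = suc (suc r)
    m = inject₁ (suc r)
    x y xy : Fin (suc (suc n)) → Carrier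
    x i = M i q
    y i = M i m
    xy i = x i + y i
    B : (u w : Fin (suc (suc n)) → Carrier) → Mat (suc (suc n))
    B u w = setCol (setCol M m u) q w
    toℕm : toℕ m ≡ suc (toℕ r)
    toℕm = ≡.cong suc (Fin.toℕ-inject₁ r)
    m≢q : m ≢ q
    m≢q h = ℕ.1+n≢n (≡.trans (≡.sym (≡.cong toℕ h)) toℕm)
    p≢q : p ≢ q
    p≢q h = ℕ.<⇒≱ ℕ.≤-refl (≡.subst (λ t → toℕ t ℕ.≤ suc (toℕ r)) h p≤r)
    at-m : ∀ u w i → B u w i m ≡ u i
    at-m u w i = ≡.trans (setCol-off (setCol M m u) q w i m m≢q) (setCol-at M m u i)
    at-q : ∀ u w i → B u w i q ≡ w i
    at-q u w i = setCol-at (setCol M m u) q w i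
    off : ∀ u w i j → j ≢ m → j ≢ q → B u w i j ≡ M i j
    off u w i j f h = ≡.trans (setCol-off (setCol M m u) q w i j h) (setCol-off M m u i j f)
    adj : ∀ u → d (B u u) ≈ 0#
    adj u = det-adjacent (suc r) (B u u) (λ i → reflexive (≡.trans (at-m u u i) (≡.sym (at-q u u i))))
    split : ∀ w → d (B xy w) ≈ d (B x w) + d (B y w)
    split w = begin
      d (B xy w)                        ≈⟨ det-cong (λ i j → reflexive (setCol-comm M m≢q xy w i j)) ⟩
      d (setCol (setCol M q w) m xy)    ≈⟨ det-setCol-+ (setCol M q w) m x y ⟩
      d (setCol (setCol M q w) m x) + d (setCol (setCol M q w) m y)
        ≈⟨ +-cong (det-cong (λ i j → reflexive (setCol-comm M m≢q x w i j)))
                  (det-cong (λ i j → reflexive (setCol-comm M m≢q y w i j))) ⟨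
      d (B x w) + d (B y w)             ∎
    zero-xy : d (B x y) ≈ 0#
    zero-xy = det-equal-cols-≤ g (B x y) (inject₁ r) p
      (≡.subst (ℕ._≤ g) (≡.sym (Fin.toℕ-inject₁ r)) r≤g)
      (ℕ.≤-pred (ℕ.≤∧≢⇒< (≡.subst (toℕ p ℕ.≤_) (≡.sym toℕm) p≤r) (p≢m ∘ Fin.toℕ-injective)))
      (λ i → begin
        B x y i p ≡⟨ off x y i p p≢m p≢q ⟩
        M i p     ≈⟨ e i ⟩
        M i q     ≡⟨ at-m x y i ⟨
        B x y i m ∎)
    restore : ∀ i j → B y x i j ≈ M i j
    restore i j = by-cases (j Fin.≟ m) (j Fin.≟ q)
      where
      by-cases : Dec (j ≡ m) → Dec (j ≡ q) → B y x i j ≈ M i j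
      by-cases (yes ≡.refl) _            = reflexive (at-m y x i)
      by-cases (no _)       (yes ≡.refl) = reflexive (at-q y x i)
      by-cases (no f)       (no h)       = reflexive (off y x i j f h)

  det-equal-cols-< : ∀ {n} (M : Mat n) (p q : Fin n) → p Fin.< q → (∀ i → M i p ≈ M i q) → det R n M ≈ 0#
  det-equal-cols-< {suc n} M p (suc r) p<q e = det-equal-cols-≤ (toℕ r) M r p ℕ.≤-refl (ℕ.≤-pred p<q) e

  det-equal-cols : ∀ {n} (M : Mat n) (p q : Fin n) → p ≢ q → (∀ i → M i p ≈ M i q) → det R n M ≈ 0#
  det-equal-cols M p q p≢q e with Fin.<-cmp p q
  ... | tri< p<q _ _ = det-equal-cols-< M p q p<q e
  ... | tri≈ _ p≡q _ = contradiction p≡q p≢q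
  ... | tri> _ _ q<p = det-equal-cols-< M q p q<p (sym ∘ e)

  -- By linearity in column l the left side is a combination of determinants with column k copied
  -- into place l. A repeated column kills all of them except k = l.
  cramer : ∀ {n} (M : Mat n) (l : Fin n) (v : Fin n → Carrier) →
    det R n (setCol M l (λ i → sum (λ j → v j * M i j))) ≈ v l * det R n M
  cramer {n} M l v = begin
    det R n (setCol M l w)         ≈⟨ det-linear l v N (setCol M l w) off at ⟩
    sum (λ k → v k * det R n (N k)) ≈⟨ sum-single l (λ k k≢l → trans (*-congˡ (others k k≢l)) (zeroʳ _)) ⟩
    v l * det R n (N l)            ≈⟨ *-congˡ (det-setCol-self M l) ⟩
    v l * det R n M                ∎
    where
    w : Fin n → Carrier
    w i = sum (λ j → v j * M i j)
    N : Fin n → Mat n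
    N k = setCol M l (λ i → M i k)
    off : ∀ k i j → j ≢ l → N k i j ≈ setCol M l w i j
    off k i j ne = reflexive (≡.trans (setCol-off M l _ i j ne) (≡.sym (setCol-off M l _ i j ne)))
    at : ∀ i → setCol M l w i l ≈ sum (λ k → v k * N k i l)
    at i = trans (reflexive (setCol-at M l w i))
      (sum-cong-≋ (λ k → *-congˡ (reflexive (≡.sym (setCol-at M l (λ i → M i k) i)))))
    others : ∀ k → k ≢ l → det R n (N k) ≈ 0#
    others k k≢l = det-equal-cols (N k) k l k≢l
      (λ i → reflexive (≡.trans (setCol-off M l _ i k k≢l) (≡.sym (setCol-at M l _ i))))

  det-zero-col : ∀ {n} (M : Mat n) (l : Fin n) → (∀ i → M i l ≈ 0#) → det R n M ≈ 0#
  det-zero-col M l e = det-linear {K = 0} l (λ ()) (λ ()) M (λ ()) e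

  -- Every minor of the first row other than the one deleting column l still contains that column,
  -- which is zero there.
  det-first-row : ∀ {n} (M : Mat (suc n)) (l : Fin (suc n)) → (∀ i → M (suc i) l ≈ 0#) →
    det R (suc n) M ≈ sgn R (toℕ l) (M zero l * det R n (minor M l))
  det-first-row {n} M l e = trans (reflexive (det-expand M)) (sum-single l others)
    where
    others : ∀ j → j ≢ l → term M j ≈ 0#
    others j j≢l = sgn-0 (toℕ j) (trans (*-congˡ (det-zero-col (minor M j) (punchOut j≢l)
      (λ a → trans (reflexive (≡.cong (M (suc a)) (≡.trans (skip≡punchIn j _) (Fin.punchIn-punchOut j≢l)))) (e a)))) (zeroʳ _))

-- Linear algebra over a finite field: singular matrices and null vectors

module FieldTheory {c ℓ : Level} {q : ℕ} (F : FiniteField c ℓ q) where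
  open FiniteField F renaming (ring to R)
  open CommutativeRing R hiding (zero)
  open Determinant R
  open import Algebra.Properties.Ring ring using (-‿distribˡ-*; -0#≈0#; -‿involutive)
  open import Algebra.Properties.Semiring.Sum semiring
  open import Relation.Binary.Reasoning.Setoid setoid

  *-cancel-0 : ∀ {x y} → ¬ (x ≈ 0#) → x * y ≈ 0# → y ≈ 0#
  *-cancel-0 {x} {y} x≉0 e with inverse x x≉0
  ... | z , xz≈1 = begin
    y           ≈⟨ *-identityˡ y ⟨
    1# * y      ≈⟨ *-congʳ (trans (*-comm z x) xz≈1) ⟨
    (z * x) * y ≈⟨ *-assoc z x y ⟩
    z * (x * y) ≈⟨ *-congˡ e ⟩
    z * 0#      ≈⟨ zeroʳ z ⟩
    0#          ∎

  *-nonzero : ∀ {x y} → ¬ (x ≈ 0#) → ¬ (y ≈ 0#) → ¬ (x * y ≈ 0#)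
  *-nonzero x≉0 y≉0 e = y≉0 (*-cancel-0 x≉0 e)

  neg-cancel-0 : ∀ {x} → - x ≈ 0# → x ≈ 0#
  neg-cancel-0 e = trans (sym (-‿involutive _)) (trans (-‿cong e) -0#≈0#)

  sgn-cancel-0 : ∀ i {x} → sgn R i x ≈ 0# → x ≈ 0#
  sgn-cancel-0 zero    e = e
  sgn-cancel-0 (suc i) e = sgn-cancel-0 i (neg-cancel-0 e)

  dot : ∀ {n} → (Fin n → Carrier) → (Fin n → Carrier) → Carrier
  dot v a = sum (λ j → v j * a j)

  Nonzero : ∀ {n} → (Fin n → Carrier) → Set ℓ
  Nonzero v = ∃ λ i → ¬ (v i ≈ 0#)

  dot-insert : ∀ {n} (l : Fin (suc n)) (u : Fin n → Carrier) (a : Fin (suc n) → Carrier) →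
    dot (insertAt u l 0#) a ≈ dot u (a ∘ punchIn l)
  dot-insert l u a = begin
    dot (insertAt u l 0#) a ≈⟨ sum-remove {i = l} (λ j → insertAt u l 0# j * a j) ⟩
    insertAt u l 0# l * a l + sum (λ b → insertAt u l 0# (punchIn l b) * a (punchIn l b))
      ≈⟨ +-cong (trans (*-congʳ (reflexive (insertAt-lookup u l 0#))) (zeroˡ _))
           (sum-cong-≋ (λ b → *-congʳ (reflexive (insertAt-punchIn u l 0# b)))) ⟩
    0# + dot u (a ∘ punchIn l) ≈⟨ +-identityˡ _ ⟩
    dot u (a ∘ punchIn l) ∎

  insert-nonzero : ∀ {n} (l : Fin (suc n)) {u : Fin n → Carrier} → Nonzero u → Nonzero (insertAt u l 0#)
  insert-nonzero l {u} (i , ne) = punchIn l i , λ e → ne (trans (reflexive (≡.sym (insertAt-punchIn u l 0# i))) e)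

  dot-combine : ∀ {n} x y (v w a : Fin n → Carrier) →
    dot (λ j → x * v j + y * w j) a ≈ x * dot v a + y * dot w a
  dot-combine x y v w a = begin
    dot (λ j → x * v j + y * w j) a
      ≈⟨ sum-cong-≋ (λ j → trans (distribʳ (a j) _ _) (+-cong (*-assoc x _ _) (*-assoc y _ _))) ⟩
    sum (λ j → x * (v j * a j) + y * (w j * a j))
      ≈⟨ ∑-distrib-+ (λ j → x * (v j * a j)) (λ j → y * (w j * a j)) ⟩
    sum (λ j → x * (v j * a j)) + sum (λ j → y * (w j * a j))
      ≈⟨ +-cong (*-distribˡ-sum x (λ j → v j * a j)) (*-distribˡ-sum y (λ j → w j * a j)) ⟨
    x * dot v a + y * dot w a ∎

  -- Two null vectors of A, told apart by the coordinate l, span a plane, which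
  -- contains a nonzero vector orthogonal to one further row.
  extra-row : ∀ {n r} (A : Fin r → Fin n → Carrier) (row v w : Fin n → Carrier) (l : Fin n) →
    ¬ (v l ≈ 0#) → w l ≈ 0# → Nonzero w →
    (∀ i → dot v (A i) ≈ 0#) → (∀ i → dot w (A i) ≈ 0#) →
    ∃ λ u → Nonzero u × dot u row ≈ 0# × (∀ i → dot u (A i) ≈ 0#)
  extra-row A row v w l vl wl w≉0 v⊥ w⊥ with dot v row ≈? 0# | dot w row ≈? 0#
  ... | yes e | _     = v , (l , vl) , e , v⊥
  ... | no _  | yes f = w , w≉0 , f , w⊥
  ... | no _  | no f  = u , (l , u≉0) , u⊥row , u⊥
    where
    x y : Carrier
    x = dot w row
    y = - dot v row
    u : Fin _ → Carrier
    u j = x * v j + y * w j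
    u≉0 : ¬ (u l ≈ 0#)
    u≉0 h = *-nonzero f vl (begin
      x * v l           ≈⟨ +-identityʳ _ ⟨
      x * v l + 0#      ≈⟨ +-congˡ (trans (*-congˡ wl) (zeroʳ y)) ⟨
      u l               ≈⟨ h ⟩
      0#                ∎)
    u⊥row : dot u row ≈ 0#
    u⊥row = begin
      dot u row                                 ≈⟨ dot-combine x y v w row ⟩
      x * dot v row + - dot v row * x           ≈⟨ +-cong (*-comm x _) (sym (-‿distribˡ-* _ x)) ⟩
      dot v row * x + - (dot v row * x)         ≈⟨ -‿inverseʳ _ ⟩
      0#                                        ∎
    u⊥ : ∀ i → dot u (A i) ≈ 0#
    u⊥ i = begin
      dot u (A i)                         ≈⟨ dot-combine x y v w (A i) ⟩
      x * dot v (A i) + y * dot w (A i)   ≈⟨ +-cong (trans (*-congˡ (v⊥ i)) (zeroʳ x)) (trans (*-congˡ (w⊥ i)) (zeroʳ y)) ⟩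
      0# + 0#                             ≈⟨ +-identityˡ 0# ⟩
      0#                                  ∎

  -- Set the first row aside. Deleting the first column gives a null vector v of the other rows;
  -- deleting next a column where v is nonzero gives a second one, w, that vanishes there. The two
  -- are independent, and `extra-row` combines them to meet the first row as well.
  underdetermined : ∀ r (A : Fin r → Fin (suc r) → Carrier) →
    ∃ λ v → Nonzero v × (∀ i → dot v (A i) ≈ 0#)
  underdetermined zero    A = (λ _ → 1#) , (zero , 1≉0) , λ ()
  underdetermined (suc r) A with underdetermined r (λ i → A (suc i) ∘ suc)
  ... | v , (b , vb) , v⊥ with underdetermined r (λ i → A (suc i) ∘ punchIn (suc b))
  ...   | w , w≉0 , w⊥ with extra-row (A ∘ suc) (A zero) (insertAt v zero 0#) (insertAt w (suc b) 0#) (suc b) vb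
                              (reflexive (insertAt-lookup w (suc b) 0#)) (insert-nonzero (suc b) w≉0)
                              (λ i → trans (dot-insert zero v (A (suc i))) (v⊥ i))
                              (λ i → trans (dot-insert (suc b) w (A (suc i))) (w⊥ i))
  ...     | u , u≉0 , e , u⊥ = u , u≉0 , λ { zero → e ; (suc i) → u⊥ i }

  NullVector : ∀ {n} → Mat n → Set _
  NullVector M = ∃ λ v → Nonzero v × (∀ i → dot v (M i) ≈ 0#)

  null⇒det≈0 : ∀ {n} (M : Mat n) → NullVector M → det R n M ≈ 0#
  null⇒det≈0 M (v , (l , vl) , v⊥) = *-cancel-0 vl (trans (sym (cramer M l v))
    (det-zero-col _ l (λ i → trans (reflexive (setCol-at M l _ i)) (v⊥ i))))

  -- Take v orthogonal to all rows but the first, with v l nonzero, and suppose that it misses the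
  -- first row. Replacing column l by M v leaves one nonzero entry in that column, so Cramer's rule
  -- makes the minor without the first row and column l singular. Its null vector, extended by 0 at
  -- l, is independent of v, and `extra-row` applies again.
  det≈0⇒null : ∀ {n} (M : Mat n) → det R n M ≈ 0# → NullVector M
  det≈0⇒null {zero}  M e = contradiction e 1≉0
  det≈0⇒null {suc n} M e with underdetermined n (M ∘ suc)
  ... | v , (l , vl) , v⊥ with dot v (M zero) ≈? 0#
  ...   | yes f = v , (l , vl) , λ { zero → f ; (suc i) → v⊥ i }
  ...   | no f with det≈0⇒null (minor M l) minor≈0
    where
    C : Mat (suc n)
    C = setCol M l (λ i → dot v (M i))
    C-minor : ∀ a b → minor C l a b ≈ minor M l a b
    C-minor a b = reflexive (setCol-off M l _ (suc a) (skip R l b)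
      (λ h → Fin.punchInᵢ≢i l b (≡.trans (≡.sym (skip≡punchIn l b)) h)))
    minor≈0 : det R n (minor M l) ≈ 0#
    minor≈0 = *-cancel-0 f (sgn-cancel-0 (toℕ l) (begin
      sgn R (toℕ l) (dot v (M zero) * det R n (minor M l))
        ≈⟨ sgn-cong (toℕ l) (*-cong (reflexive (setCol-at M l _ zero)) (det-cong C-minor)) ⟨
      sgn R (toℕ l) (C zero l * det R n (minor C l))
        ≈⟨ det-first-row C l (λ i → trans (reflexive (setCol-at M l _ (suc i))) (v⊥ i)) ⟨
      det R (suc n) C    ≈⟨ cramer M l v ⟩
      v l * det R (suc n) M ≈⟨ *-congˡ e ⟩
      v l * 0#              ≈⟨ zeroʳ _ ⟩
      0#                    ∎))
  ...     | w , w≉0 , w⊥ with extra-row (M ∘ suc) (M zero) v (insertAt w l 0#) l vl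
                                (reflexive (insertAt-lookup w l 0#)) (insert-nonzero l w≉0) v⊥
                                (λ i → trans (dot-insert l w (M (suc i)))
                                  (trans (sum-cong-≋ (λ b → *-congˡ (reflexive
                                    (≡.cong (M (suc i)) (≡.sym (skip≡punchIn l b)))))) (w⊥ i)))
  ...       | u , u≉0 , g , u⊥ = u , u≉0 , λ { zero → g ; (suc i) → u⊥ i }

-- Kernels of pairs of power series

module Convolution {c ℓ : Level} (R : CommutativeRing c ℓ) where
  open CommutativeRing R hiding (zero)
  open import Algebra.Solver.Ring.NaturalCoefficients.Default commutativeSemiring
    using (solve; _:=_; _:+_; _:*_)
  open import Relation.Binary.Reasoning.Setoid setoid

  Series : Set c
  Series = ℕ → Carrier

  conv : Series → Series → Series
  conv α p zero    = α zero * p zero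
  conv α p (suc i) = α zero * p (suc i) + conv (α ∘ suc) p i

  conv-cong : ∀ i {α β p r : Series} → (∀ j → α j ≈ β j) → (∀ j → j ℕ.≤ i → p j ≈ r j) →
    conv α p i ≈ conv β r i
  conv-cong zero    e f = *-cong (e zero) (f zero ℕ.z≤n)
  conv-cong (suc i) e f = +-cong (*-cong (e zero) (f (suc i) ℕ.≤-refl))
    (conv-cong i (e ∘ suc) (λ j j≤i → f j (ℕ.m≤n⇒m≤1+n j≤i)))

  conv-0ˡ : ∀ i {α} p → (∀ j → α j ≈ 0#) → conv α p i ≈ 0#
  conv-0ˡ zero    p e = trans (*-congʳ (e zero)) (zeroˡ _)
  conv-0ˡ (suc i) p e = trans (+-cong (trans (*-congʳ (e zero)) (zeroˡ _)) (conv-0ˡ i p (e ∘ suc))) (+-identityˡ 0#)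

  conv-linearˡ : ∀ i x y (α β p : Series) →
    conv (λ j → x * α j + y * β j) p i ≈ x * conv α p i + y * conv β p i
  conv-linearˡ zero x y α β p =
    solve 5 (λ x y a b p → (x :* a :+ y :* b) :* p := x :* (a :* p) :+ y :* (b :* p)) refl x y (α zero) (β zero) (p zero)
  conv-linearˡ (suc i) x y α β p = trans (+-congˡ (conv-linearˡ i x y (α ∘ suc) (β ∘ suc) p))
    (solve 7 (λ x y a b p s t → (x :* a :+ y :* b) :* p :+ (x :* s :+ y :* t)
                := x :* (a :* p :+ s) :+ y :* (b :* p :+ t)) refl
      x y (α zero) (β zero) (p (suc i)) (conv (α ∘ suc) p i) (conv (β ∘ suc) p i))

  conv-linearʳ : ∀ i x y (α p r : Series) →
    conv α (λ j → x * p j + y * r j) i ≈ x * conv α p i + y * conv α r i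
  conv-linearʳ zero x y α p r =
    solve 5 (λ x y a p r → a :* (x :* p :+ y :* r) := x :* (a :* p) :+ y :* (a :* r)) refl x y (α zero) (p zero) (r zero)
  conv-linearʳ (suc i) x y α p r = trans (+-congˡ (conv-linearʳ i x y (α ∘ suc) p r))
    (solve 7 (λ x y a p r s t → a :* (x :* p :+ y :* r) :+ (x :* s :+ y :* t)
                := x :* (a :* p :+ s) :+ y :* (a :* r :+ t)) refl
      x y (α zero) (p (suc i)) (r (suc i)) (conv (α ∘ suc) p i) (conv (α ∘ suc) r i))

  conv-scaleˡ : ∀ i x (α p : Series) → conv (λ j → x * α j) p i ≈ x * conv α p i
  conv-scaleˡ zero x α p = *-assoc x _ _
  conv-scaleˡ (suc i) x α p = trans (+-cong (*-assoc x _ _) (conv-scaleˡ i x (α ∘ suc) p)) (sym (distribˡ x _ _))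

  conv-tailˡ : ∀ i (α p : Series) → α zero ≈ 0# → conv α p (suc i) ≈ conv (α ∘ suc) p i
  conv-tailˡ i α p e = trans (+-congʳ (trans (*-congʳ e) (zeroˡ _))) (+-identityˡ _)

  conv-tailʳ : ∀ i (α p : Series) → p zero ≈ 0# → conv α p (suc i) ≈ conv α (p ∘ suc) i
  conv-tailʳ zero    α p e = trans (+-congˡ (trans (*-congˡ e) (zeroʳ _))) (+-identityʳ _)
  conv-tailʳ (suc i) α p e = +-congˡ (conv-tailʳ i (α ∘ suc) p e)

module Kernel {c ℓ : Level} {q : ℕ} (F : FiniteField c ℓ q) where
  open FiniteField F renaming (ring to R)
  open CommutativeRing R hiding (zero)
  open Convolution R public
  open FieldTheory F using (*-cancel-0; *-nonzero)
  open import Algebra.Properties.Ring ring using (-‿distribˡ-*; -0#≈0#)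
  open import Algebra.Solver.Ring.NaturalCoefficients.Default commutativeSemiring
    using (solve; _:=_; _:+_; _:*_)
  open import Relation.Binary.Reasoning.Setoid setoid

  Supported : ℕ → Series → Set ℓ
  Supported a α = ∀ i → a ℕ.≤ i → α i ≈ 0#

  -- A nonzero pair of polynomials with α p + β c ≡ 0 modulo the m-th power.
  Ker : (a b m : ℕ) → Series → Series → Set _
  Ker a b m p c = ∃ λ α → ∃ λ β → Supported a α × Supported b β ×
    (∃ λ i → ¬ (α i ≈ 0#) ⊎ ¬ (β i ≈ 0#)) ×
    (∀ i → i ℕ.< m → conv α p i + conv β c i ≈ 0#)

  Ker-cong : ∀ a b m {p p′ c c′} → (∀ i → i ℕ.< m → p i ≈ p′ i) → (∀ i → i ℕ.< m → c i ≈ c′ i) →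
    Ker a b m p c → Ker a b m p′ c′
  Ker-cong a b m e f (α , β , sα , sβ , nz , eqn) = α , β , sα , sβ , nz , λ i i<m → trans (sym (+-cong
    (conv-cong i (λ _ → refl) (λ j j≤i → e j (ℕ.≤-<-trans j≤i i<m)))
    (conv-cong i (λ _ → refl) (λ j j≤i → f j (ℕ.≤-<-trans j≤i i<m))))) (eqn i i<m)

  Ker-swap : ∀ {a b m p c} → Ker a b m p c → Ker b a m c p
  Ker-swap (α , β , sα , sβ , nz , eqn) = β , α , sβ , sα , swap nz , λ i i<m → trans (+-comm _ _) (eqn i i<m)
    where
    swap : (∃ λ i → ¬ (α i ≈ 0#) ⊎ ¬ (β i ≈ 0#)) → ∃ λ i → ¬ (β i ≈ 0#) ⊎ ¬ (α i ≈ 0#)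
    swap (i , inj₁ h) = i , inj₂ h
    swap (i , inj₂ h) = i , inj₁ h

  -- The series c₀ p - p₀ c has no constant term; this is its quotient by the variable s. The
  -- undivided combination is `cross`.
  eliminate : Series → Series → Series
  eliminate p c i = c zero * p (suc i) + - p zero * c (suc i)

  cross : Series → Series → Series
  cross p c i = c zero * p i + - p zero * c i

  cross-0 : ∀ p c → cross p c zero ≈ 0#
  cross-0 p c = begin
    c zero * p zero + - p zero * c zero     ≈⟨ +-cong (*-comm _ _) (sym (-‿distribˡ-* _ _)) ⟩
    p zero * c zero + - (p zero * c zero)   ≈⟨ -‿inverseʳ _ ⟩
    0#                                      ∎

  cancel : ∀ x y z → y + (- x * z + x * z) ≈ y
  cancel x y z = trans (+-congˡ (trans (+-congʳ (sym (-‿distribˡ-* x z))) (-‿inverseˡ _))) (+-identityʳ y)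

  -- The step rests on the identity c₀ (α p + β c) = α (c₀ p - p₀ c) + γ c with γ = p₀ α + c₀ β.
  -- Both summands on the right are divisible by s once γ is, and the new pair is (α, γ/s). The
  -- assumption `hyp` keeps p₀ α, and so γ, within b + 1 coefficients.
  module Step (p c : Series) (c₀≉0 : ¬ (c zero ≈ 0#)) (a b m : ℕ) (hyp : a ℕ.≤ suc b ⊎ p zero ≈ 0#) where

    p₀α≈0 : ∀ {α} → Supported a α → ∀ i → suc b ℕ.≤ i → p zero * α i ≈ 0#
    p₀α≈0 sα i b<i = [ (λ a≤b → trans (*-congˡ (sα i (ℕ.≤-trans a≤b b<i))) (zeroʳ _))
                     , (λ p₀≈0 → trans (*-congʳ p₀≈0) (zeroˡ _)) ]′ hyp

    forward : Ker a (suc b) (suc m) p c → Ker a b m (eliminate p c) c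
    forward (α , β , sα , sβ , (i₀ , nz) , eqn) = α , γ ∘ suc , sα , sγ , nonzero i₀ nz , eqn′
      where
      γ : Series
      γ j = p zero * α j + c zero * β j
      -- This is the constant term of α p + β c, so the lowest of the given equations makes γ
      -- divisible by s.
      γ₀ : γ zero ≈ 0#
      γ₀ = trans (+-cong (*-comm _ _) (*-comm _ _)) (eqn zero (ℕ.s≤s ℕ.z≤n))
      sγ : Supported b (γ ∘ suc)
      sγ i b≤i = trans (+-cong (p₀α≈0 sα (suc i) (ℕ.s≤s b≤i))
        (trans (*-congˡ (sβ (suc i) (ℕ.s≤s b≤i))) (zeroʳ _))) (+-identityˡ 0#)
      γ≈cβ : ∀ i → α i ≈ 0# → γ i ≈ c zero * β i
      γ≈cβ i e = trans (+-congʳ (trans (*-congˡ e) (zeroʳ _))) (+-identityˡ _)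
      nonzero : ∀ i → ¬ (α i ≈ 0#) ⊎ ¬ (β i ≈ 0#) → ∃ λ i → ¬ (α i ≈ 0#) ⊎ ¬ (γ (suc i) ≈ 0#)
      nonzero i (inj₁ h) = i , inj₁ h
      nonzero i (inj₂ h) with α i ≈? 0#
      nonzero i       (inj₂ h) | no g  = i , inj₁ g
      nonzero zero    (inj₂ h) | yes e = contradiction (trans (sym (γ≈cβ zero e)) γ₀) (*-nonzero c₀≉0 h)
      nonzero (suc i) (inj₂ h) | yes e = i , inj₂ (λ g → *-nonzero c₀≉0 h (trans (sym (γ≈cβ (suc i) e)) g))
      eqn′ : ∀ i → i ℕ.< m → conv α (eliminate p c) i + conv (γ ∘ suc) c i ≈ 0#
      eqn′ i i<m = begin
        conv α (eliminate p c) i + conv (γ ∘ suc) c i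
          ≈⟨ +-cong (conv-tailʳ i α (cross p c) (cross-0 p c)) (conv-tailˡ i γ c γ₀) ⟨
        conv α (cross p c) (suc i) + conv γ c (suc i)
          ≈⟨ +-cong (conv-linearʳ (suc i) (c zero) (- p zero) α p c) (conv-linearˡ (suc i) (p zero) (c zero) α β c) ⟩
        (c zero * A + - p zero * B) + (p zero * B + c zero * C)
          ≈⟨ solve 6 (λ x y n A B C → (x :* A :+ n :* B) :+ (y :* B :+ x :* C) := x :* (A :+ C) :+ (n :* B :+ y :* B))
               refl (c zero) (p zero) (- p zero) A B C ⟩
        c zero * (A + C) + (- p zero * B + p zero * B) ≈⟨ cancel (p zero) _ B ⟩
        c zero * (A + C)                               ≈⟨ *-congˡ (eqn (suc i) (ℕ.s≤s i<m)) ⟩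
        c zero * 0#                                    ≈⟨ zeroʳ _ ⟩
        0#                                             ∎
        where A = conv α p (suc i)
              B = conv α c (suc i)
              C = conv β c (suc i)

    backward : Ker a b m (eliminate p c) c → Ker a (suc b) (suc m) p c
    backward (α , β , sα , sβ , (i₀ , nz) , eqn) = α′ , β′ , sα′ , sβ′ , nonzero i₀ nz , eqn′
      where
      shift : Series
      shift zero    = 0#
      shift (suc j) = β j
      α′ β′ : Series
      -- Solving γ = s β for the original pair would require division by c₀; scaling that pair by c₀
      -- avoids it. The factor 1 in `β′` gives it the shape of `conv-linearˡ`.
      α′ j = c zero * α j
      β′ j = 1# * shift j + - p zero * α j
      sα′ : Supported a α′
      sα′ i a≤i = trans (*-congˡ (sα i a≤i)) (zeroʳ _)
      sβ′ : Supported (suc b) β′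
      sβ′ (suc i) (ℕ.s≤s b≤i) = trans (+-cong (trans (*-identityˡ _) (sβ i b≤i))
        (trans (sym (-‿distribˡ-* _ _)) (trans (-‿cong (p₀α≈0 sα (suc i) (ℕ.s≤s b≤i))) -0#≈0#))) (+-identityˡ 0#)
      nonzero : ∀ i → ¬ (α i ≈ 0#) ⊎ ¬ (β i ≈ 0#) → ∃ λ i → ¬ (α′ i ≈ 0#) ⊎ ¬ (β′ i ≈ 0#)
      nonzero i (inj₁ h) = i , inj₁ (*-nonzero c₀≉0 h)
      -- The coefficient β i moves to place i + 1, where only α can cancel it; if α is nonzero
      -- there, `α′` is the witness instead.
      nonzero i (inj₂ h) with α (suc i) ≈? 0#
      ... | no g  = suc i , inj₁ (*-nonzero c₀≉0 g)
      ... | yes e = suc i , inj₂ (λ g → h (begin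
        β i           ≈⟨ *-identityˡ _ ⟨
        1# * β i      ≈⟨ +-identityʳ _ ⟨
        1# * β i + 0# ≈⟨ +-congˡ (trans (*-congˡ e) (zeroʳ _)) ⟨
        β′ (suc i)    ≈⟨ g ⟩
        0#            ∎))
      regroup : ∀ i → conv α′ p i + conv β′ c i ≈ conv α (cross p c) i + conv shift c i
      regroup i = begin
        conv α′ p i + conv β′ c i
          ≈⟨ +-cong (conv-scaleˡ i (c zero) α p) (conv-linearˡ i 1# (- p zero) shift α c) ⟩
        c zero * A + (1# * S + - p zero * B)  ≈⟨ +-congˡ (trans (+-congʳ (*-identityˡ S)) (+-comm _ _)) ⟩
        c zero * A + (- p zero * B + S)       ≈⟨ +-assoc _ _ _ ⟨
        (c zero * A + - p zero * B) + S       ≈⟨ +-congʳ (conv-linearʳ i (c zero) (- p zero) α p c) ⟨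
        conv α (cross p c) i + S              ∎
        where A = conv α p i
              B = conv α c i
              S = conv shift c i
      eqn′ : ∀ i → i ℕ.< suc m → conv α′ p i + conv β′ c i ≈ 0#
      eqn′ zero    i<m = trans (regroup zero) (trans (+-cong (trans (*-congˡ (cross-0 p c)) (zeroʳ _)) (zeroˡ _)) (+-identityˡ 0#))
      eqn′ (suc i) (ℕ.s≤s i<m) = trans (regroup (suc i))
        (trans (+-cong (conv-tailʳ i α (cross p c) (cross-0 p c)) (conv-tailˡ i shift c refl)) (eqn i i<m))

    step : Ker a (suc b) (suc m) p c ⇔ Ker a b m (eliminate p c) c
    step = mk⇔ forward backward

  open Step using (step) public

  step-swap : ∀ p c → ¬ (p zero ≈ 0#) → ∀ a b m → b ℕ.≤ suc a →
    Ker (suc a) b (suc m) p c ⇔ Ker b a m (eliminate c p) p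
  step-swap p c p₀≉0 a b m b≤a = ⇔-trans (mk⇔ Ker-swap Ker-swap) (step c p p₀≉0 b a m (inj₁ b≤a))

  -- Truncated division by a series with invertible constant term: each equation removes the lowest
  -- remaining coefficient of β.
  conv-injective : ∀ i (β c : Series) → ¬ (c zero ≈ 0#) → (∀ j → j ℕ.≤ i → conv β c j ≈ 0#) → β i ≈ 0#
  conv-injective zero    β c c₀≉0 e = *-cancel-0 c₀≉0 (trans (*-comm _ _) (e zero ℕ.z≤n))
  conv-injective (suc i) β c c₀≉0 e = conv-injective i (β ∘ suc) c c₀≉0
    (λ j j≤i → trans (sym (conv-tailˡ j β c β₀≈0)) (e (suc j) (ℕ.s≤s j≤i)))
    where
    β₀≈0 : β zero ≈ 0#
    β₀≈0 = conv-injective zero β c c₀≉0 (λ { zero _ → e zero ℕ.z≤n })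

  ¬Ker-0 : ∀ b p c → ¬ (c zero ≈ 0#) → ¬ Ker 0 b b p c
  ¬Ker-0 b p c c₀≉0 (α , β , sα , sβ , (i , inj₁ nz) , eqn) = nz (sα i ℕ.z≤n)
  ¬Ker-0 b p c c₀≉0 (α , β , sα , sβ , (i , inj₂ nz) , eqn) with ℕ.<-≤-connex i b
  ... | inj₂ b≤i = nz (sβ i b≤i)
  ... | inj₁ i<b = nz (conv-injective i β c c₀≉0 (λ j j≤i → begin
    conv β c j              ≈⟨ +-identityˡ _ ⟨
    0# + conv β c j         ≈⟨ +-congʳ (conv-0ˡ j p (λ k → sα k ℕ.z≤n)) ⟨
    conv α p j + conv β c j ≈⟨ eqn j (ℕ.≤-<-trans j≤i i<b) ⟩
    0#                      ∎))

  monomial : ℕ → Series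
  monomial zero    zero    = 1#
  monomial zero    (suc j) = 0#
  monomial (suc k) zero    = 0#
  monomial (suc k) (suc j) = monomial k j

  monomial-supported : ∀ k → Supported (suc k) (monomial k)
  monomial-supported zero    (suc j) _         = refl
  monomial-supported (suc k) (suc j) (ℕ.s≤s h) = monomial-supported k j h

  monomial-diagonal : ∀ k → monomial k k ≡ 1#
  monomial-diagonal zero    = ≡.refl
  monomial-diagonal (suc k) = monomial-diagonal k

  conv-monomial : ∀ k p → p zero ≈ 0# → ∀ i → i ℕ.≤ k → conv (monomial k) p i ≈ 0#
  conv-monomial zero    p e zero    _         = trans (*-congˡ e) (zeroʳ _)
  conv-monomial (suc k) p e zero    _         = zeroˡ _
  conv-monomial (suc k) p e (suc i) (ℕ.s≤s h) = trans (conv-tailˡ i (monomial (suc k)) p refl) (conv-monomial k p e i h)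

  -- Here p is divisible by s, so the monomial of degree a multiplies it into the ideal of the power
  -- a + 1.
  Ker-p₀≈0 : ∀ a p c → p zero ≈ 0# → Ker (suc a) 0 (suc a) p c
  Ker-p₀≈0 a p c e = monomial a , (λ _ → 0#) , monomial-supported a , (λ _ _ → refl) ,
    (a , inj₁ (λ h → 1≉0 (trans (reflexive (≡.sym (monomial-diagonal a))) h))) ,
    λ i i<a → trans (+-cong (conv-monomial a p e i (ℕ.≤-pred i<a)) (conv-0ˡ i c (λ _ → refl))) (+-identityˡ 0#)

  -- The Euclidean algorithm serves as decision procedure, with the case split that the count uses
  -- later. It ends with one polynomial empty: then no pair exists if the remaining series has
  -- nonzero constant term, and a monomial works otherwise.
  ker? : ∀ m a b p c → a ℕ.+ b ≡ m → ¬ (c zero ≈ 0#) → Dec (Ker a b m p c)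
  ker? m zero b p c ≡.refl c₀≉0 = no (¬Ker-0 b p c c₀≉0)
  ker? m (suc a) zero p c eq c₀≉0 with ≡.trans (≡.sym (ℕ.+-identityʳ (suc a))) eq | p zero ≈? 0#
  ... | ≡.refl | yes e = yes (Ker-p₀≈0 a p c e)
  ... | ≡.refl | no h  = no (¬Ker-0 (suc a) c p h ∘ Ker-swap)
  ker? (suc m) (suc a) (suc b) p c eq c₀≉0 with suc a ℕ.≤? suc b | p zero ≈? 0#
  ... | yes a≤b | _     = Dec.map (⇔-sym (step p c c₀≉0 (suc a) b m (inj₁ a≤b)))
                            (ker? m (suc a) b (eliminate p c) c (ℕ.suc-injective (≡.trans (≡.sym (ℕ.+-suc (suc a) b)) eq)) c₀≉0)
  ... | no _    | yes e = Dec.map (⇔-sym (step p c c₀≉0 (suc a) b m (inj₂ e)))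
                            (ker? m (suc a) b (eliminate p c) c (ℕ.suc-injective (≡.trans (≡.sym (ℕ.+-suc (suc a) b)) eq)) c₀≉0)
  ... | no a≰b  | no h  = Dec.map (⇔-sym (step-swap p c h a (suc b) m (ℕ.<⇒≤ (ℕ.≰⇒> a≰b))))
                            (ker? m (suc b) a (eliminate c p) p (ℕ.suc-injective (≡.trans (≡.cong suc (ℕ.+-comm (suc b) a)) eq)) h)

-- Counting over the field

indicator : ∀ {p} {P : Set p} → Dec P → ℕ
indicator P? = if does P? then 1 else 0

indicator-⇔ : ∀ {p r} {P : Set p} {Q : Set r} (P? : Dec P) (Q? : Dec Q) → P ⇔ Q → indicator P? ≡ indicator Q?
indicator-⇔ (yes p) (yes r) e = ≡.refl
indicator-⇔ (yes p) (no ¬r) e = contradiction (Equivalence.to e p) ¬r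
indicator-⇔ (no ¬p) (yes r) e = contradiction (Equivalence.from e r) ¬p
indicator-⇔ (no ¬p) (no ¬r) e = ≡.refl

module Counting {c ℓ : Level} {q : ℕ} (F : FiniteField c ℓ q) where
  open FiniteField F renaming (ring to R)
  open CommutativeRing R hiding (zero)
  open Kernel F
  open ℕΣ using (sum-cong-≗)

  Σq : (Carrier → ℕ) → ℕ
  Σq f = ℕΣ.sum (f ∘ enum)

  Σq-cong : ∀ {f g : Carrier → ℕ} → (∀ x → f x ≡ g x) → Σq f ≡ Σq g
  Σq-cong e = sum-cong-≗ (e ∘ enum)

  Respects : (Carrier → ℕ) → Set _
  Respects f = ∀ {x y} → x ≈ y → f x ≡ f y

  index : Carrier → Fin q
  index x = proj₁ (enum-sur x)

  enum-index : ∀ x → enum (index x) ≈ x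
  enum-index x = proj₂ (enum-sur x)

  -- A bijection of the field up to ≈ becomes a permutation of `Fin q` by conjugation with `enum`
  -- and `index`.
  Σq-reindex : ∀ f → Respects f → (g g⁻¹ : Carrier → Carrier) →
    (∀ {x y} → x ≈ y → g x ≈ g y) → (∀ {x y} → x ≈ y → g⁻¹ x ≈ g⁻¹ y) →
    (∀ x → g (g⁻¹ x) ≈ x) → (∀ x → g⁻¹ (g x) ≈ x) → Σq (f ∘ g) ≡ Σq f
  Σq-reindex f f-resp g g⁻¹ g-cong g⁻¹-cong right left = begin
    Σq (f ∘ g)                                    ≡⟨ sum-cong-≗ (λ i → f-resp (sym (enum-index (g (enum i))))) ⟩
    ℕΣ.sum (λ i → f (enum (index (g (enum i)))))  ≡⟨ ℕΣ.sum-permute (f ∘ enum) π ⟨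
    Σq f                                          ∎
    where
    open ≡.≡-Reasoning
    lift : (Carrier → Carrier) → Fin q → Fin q
    lift h = index ∘ h ∘ enum
    lift-inverse : ∀ h k → (∀ {x y} → x ≈ y → h x ≈ h y) → (∀ x → h (k x) ≈ x) → ∀ i → lift h (lift k i) ≡ i
    lift-inverse h k h-cong e i = enum-inj _ _ (trans (enum-index _) (trans (h-cong (enum-index _)) (e (enum i))))
    π = Perm.permutation (lift g) (lift g⁻¹)
          (lift-inverse g g⁻¹ g-cong right) (lift-inverse g⁻¹ g g⁻¹-cong left)

  Σq-affine : ∀ f → Respects f → ∀ t s → ¬ (t ≈ 0#) → Σq (λ y → f (t * y + s)) ≡ Σq f
  Σq-affine f f-resp t s t≉0 with inverse t t≉0
  ... | t⁻¹ , tt⁻¹ = Σq-reindex f f-resp (λ y → t * y + s) (λ x → t⁻¹ * (x + - s))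
      (λ e → +-congʳ (*-congˡ e)) (λ e → *-congˡ (+-congʳ e))
      (λ x → trans (+-congʳ (undo t t⁻¹ tt⁻¹ (x + - s)))
               (trans (+-assoc _ _ _) (trans (+-congˡ (-‿inverseˡ s)) (+-identityʳ x))))
      (λ y → trans (*-congˡ (trans (+-assoc _ _ _) (trans (+-congˡ (-‿inverseʳ s)) (+-identityʳ _))))
               (undo t⁻¹ t (trans (*-comm _ _) tt⁻¹) y))
    where
    undo : ∀ a b → a * b ≈ 1# → ∀ x → a * (b * x) ≈ x
    undo a b e x = trans (sym (*-assoc a b x)) (trans (*-congʳ e) (*-identityˡ x))

  cons : Carrier → Series → Series
  cons a x zero    = a
  cons a x (suc n) = x n

  cons-cong : ∀ {a b x y} → a ≈ b → (∀ n → x n ≈ y n) → ∀ n → cons a x n ≈ cons b y n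
  cons-cong e f zero    = e
  cons-cong e f (suc n) = f n

  Extensional : (Series → ℕ) → Set _
  Extensional φ = ∀ {x y} → (∀ n → x n ≈ y n) → φ x ≡ φ y

  -- The sum of φ over all series whose coefficients from N on vanish.
  ΣS : ℕ → (Series → ℕ) → ℕ
  ΣS zero    φ = φ (λ _ → 0#)
  ΣS (suc N) φ = Σq (λ a → ΣS N (φ ∘ cons a))

  ΣS-cong : ∀ N {φ ψ : Series → ℕ} → (∀ x → φ x ≡ ψ x) → ΣS N φ ≡ ΣS N ψ
  ΣS-cong zero    e = e _
  ΣS-cong (suc N) e = Σq-cong (λ a → ΣS-cong N (e ∘ cons a))

  Σq-const : ∀ n → Σq (λ _ → n) ≡ q ℕ.* n
  Σq-const n = sum-const q
    where
    sum-const : ∀ k → ℕΣ.sum {k} (λ _ → n) ≡ k ℕ.* n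
    sum-const zero    = ≡.refl
    sum-const (suc k) = ≡.cong (n ℕ.+_) (sum-const k)

  ΣS-const : ∀ N n → ΣS N (λ _ → n) ≡ q ^ N ℕ.* n
  ΣS-const zero    n = ≡.sym (ℕ.+-identityʳ n)
  ΣS-const (suc N) n = ≡.trans (Σq-cong (λ _ → ΣS-const N n))
    (≡.trans (Σq-const (q ^ N ℕ.* n)) (≡.sym (ℕ.*-assoc q (q ^ N) n)))

  -- Linear changes of variables in the count

  Operation : Set _
  Operation = Carrier → Carrier → Carrier

  Congruent₂ : Operation → Set _
  Congruent₂ τ = ∀ {y y′ z z′} → y ≈ y′ → z ≈ z′ → τ y z ≈ τ y′ z′

  -- That (y , z) ↦ (τ₁ y z , τ₂ y z) permutes the plane is recorded by its effect on sums, ready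
  -- for use under `ΣS`.
  PreservesSums : (τ₁ τ₂ : Operation) → Set _
  PreservesSums τ₁ τ₂ = (f : Carrier → Carrier → ℕ) →
    (∀ {y y′ z z′} → y ≈ y′ → z ≈ z′ → f y z ≡ f y′ z′) →
    Σq (λ y → Σq (λ z → f (τ₁ y z) (τ₂ y z))) ≡ Σq (λ y → Σq (f y))

  Σq-swap : ∀ (f : Carrier → Carrier → ℕ) → Σq (λ y → Σq (f y)) ≡ Σq (λ z → Σq (λ y → f y z))
  Σq-swap f = ℕΣ.∑-comm (λ i j → f (enum i) (enum j))

  -- For each fixed y the first coordinate is an affine bijection in z; exchanging the two
  -- summations then restores the order of the arguments.
  preserves-shear₁ : ∀ t u → ¬ (t ≈ 0#) → PreservesSums (λ y z → t * z + u * y) (λ y z → y)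
  preserves-shear₁ t u t≉0 f f-resp = ≡.trans
    (Σq-cong (λ y → Σq-affine (λ w → f w y) (λ e → f-resp e refl) t (u * y) t≉0))
    (Σq-swap (λ y w → f w y))

  preserves-shear₂ : ∀ t u → ¬ (t ≈ 0#) → PreservesSums (λ y z → t * y + u * z) (λ y z → z)
  preserves-shear₂ t u t≉0 f f-resp = ≡.trans (Σq-swap (λ y z → f (t * y + u * z) z))
    (preserves-shear₁ t u t≉0 f f-resp)

  module _ (τ₁ τ₂ : Operation) where
    -- Only the first k pairs are changed: a kernel modulo the k-th power reads no further, and
    -- finitely many free variables can carry the change.
    mapPairs : ℕ → Series → Series
    mapPairs zero    x = x
    mapPairs (suc k) x = cons (τ₁ (x 0) (x 1)) (cons (τ₂ (x 0) (x 1)) (mapPairs k (λ n → x (suc (suc n)))))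

    ΣS-mapPairs : Congruent₂ τ₁ → Congruent₂ τ₂ → PreservesSums τ₁ τ₂ →
      ∀ k N → k ℕ.* 2 ℕ.≤ N → ∀ φ → Extensional φ → ΣS N (φ ∘ mapPairs k) ≡ ΣS N φ
    ΣS-mapPairs τ₁-cong τ₂-cong pres = go
      where
      ΣS-ext : ∀ N {φ} → Extensional φ → ∀ {a a′ b b′} → a ≈ a′ → b ≈ b′ →
        ΣS N (λ x → φ (cons a (cons b x))) ≡ ΣS N (λ x → φ (cons a′ (cons b′ x)))
      ΣS-ext N φ-ext e f = ΣS-cong N (λ x → φ-ext (cons-cong e (cons-cong f (λ _ → refl))))
      go : ∀ k N → k ℕ.* 2 ℕ.≤ N → ∀ φ → Extensional φ → ΣS N (φ ∘ mapPairs k) ≡ ΣS N φ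
      go zero    N             h                   φ φ-ext = ≡.refl
      go (suc k) (suc (suc N)) (ℕ.s≤s (ℕ.s≤s h)) φ φ-ext = ≡.trans
        (Σq-cong (λ y → Σq-cong (λ z → go k N h (λ x → φ (cons (τ₁ y z) (cons (τ₂ y z) x)))
          (λ e → φ-ext (cons-cong refl (cons-cong refl e))))))
        (pres (λ a b → ΣS N (λ x → φ (cons a (cons b x)))) (ΣS-ext N {φ} φ-ext))

  evens : Series → Series
  evens x zero    = x zero
  evens x (suc i) = evens (λ n → x (suc (suc n))) i

  evens-cong : ∀ {x y} → (∀ n → x n ≈ y n) → ∀ i → evens x i ≈ evens y i
  evens-cong e zero    = e zero
  evens-cong e (suc i) = evens-cong (λ n → e (suc (suc n))) i

  evens-mapPairs : ∀ τ₁ τ₂ k x i → i ℕ.< k →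
    evens (mapPairs τ₁ τ₂ k x) i ≡ τ₁ (evens x i) (evens (x ∘ suc) i)
  evens-mapPairs τ₁ τ₂ (suc k) x zero    h         = ≡.refl
  evens-mapPairs τ₁ τ₂ (suc k) x (suc i) (ℕ.s≤s h) = evens-mapPairs τ₁ τ₂ k (λ n → x (suc (suc n))) i h

  odds-mapPairs : ∀ τ₁ τ₂ k x i → i ℕ.< k →
    evens (mapPairs τ₁ τ₂ k x ∘ suc) i ≡ τ₂ (evens x i) (evens (x ∘ suc) i)
  odds-mapPairs τ₁ τ₂ (suc k) x zero    h         = ≡.refl
  odds-mapPairs τ₁ τ₂ (suc k) x (suc i) (ℕ.s≤s h) = odds-mapPairs τ₁ τ₂ k (λ n → x (suc (suc n))) i h

  -- With h = h₀ + x₀ t + x₁ t² + …, the entries of evens x are the odd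
  -- coefficients of h.
  Ker′ : (a b m : ℕ) → Carrier → Series → Set _
  Ker′ a b m h₀ x = Ker a b m (evens x) (evens (cons h₀ x))

  Ker′-cong : ∀ a b m h₀ {x y} → (∀ n → x n ≈ y n) → Ker′ a b m h₀ x ⇔ Ker′ a b m h₀ y
  Ker′-cong a b m h₀ e = mk⇔ (one e) (one (sym ∘ e))
    where
    one : ∀ {x y} → (∀ n → x n ≈ y n) → Ker′ a b m h₀ x → Ker′ a b m h₀ y
    one e = Ker-cong a b m (λ i _ → evens-cong e i) (λ i _ → evens-cong (cons-cong refl e) i)

  ker′? : ∀ a b m h₀ → a ℕ.+ b ≡ m → ¬ (h₀ ≈ 0#) → ∀ x → Dec (Ker′ a b m h₀ x)
  ker′? a b m h₀ eq h₀≉0 x = ker? m a b (evens x) (evens (cons h₀ x)) eq h₀≉0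

  Ker-⇔ : ∀ a b m {p p′ c c′} → (∀ i → i ℕ.< m → p i ≈ p′ i) → (∀ i → i ℕ.< m → c i ≈ c′ i) →
    Ker a b m p c ⇔ Ker a b m p′ c′
  Ker-⇔ a b m e f = mk⇔ (Ker-cong a b m e f) (Ker-cong a b m (λ i h → sym (e i h)) (λ i h → sym (f i h)))

  -- After h₀ and x₀ the coefficients come in pairs (y , z), where y is the next coefficient of c
  -- and z that of p. The new series have h₀ z - x₀ y in place of z, and y is kept. The entries also
  -- change places, since dividing by s makes the p-entry precede the c-entry.
  step₁ : ∀ a b m h₀ x₀ → ¬ (h₀ ≈ 0#) → a ℕ.≤ suc b ⊎ x₀ ≈ 0# → ∀ x →
    Ker′ a (suc b) (suc m) h₀ (cons x₀ x) ⇔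
    Ker′ a b m h₀ (mapPairs (λ y z → h₀ * z + - x₀ * y) (λ y z → y) m x)
  step₁ a b m h₀ x₀ h₀≉0 hyp x = ⇔-trans (step (evens (cons x₀ x)) (evens (cons h₀ (cons x₀ x))) h₀≉0 a b m hyp)
    (Ker-⇔ a b m (λ i h → reflexive (≡.sym (evens-mapPairs _ _ m x i h)))
      (λ { zero h → refl ; (suc i) h → reflexive (≡.sym (odds-mapPairs _ _ m x i (ℕ.≤-trans (ℕ.n≤1+n _) h))) }))

  step₂ : ∀ a b m h₀ x₀ → ¬ (x₀ ≈ 0#) → b ℕ.≤ suc a → ∀ x →
    Ker′ (suc a) b (suc m) h₀ (cons x₀ x) ⇔
    Ker′ b a m x₀ (mapPairs (λ y z → x₀ * y + - h₀ * z) (λ y z → z) m x)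
  step₂ a b m h₀ x₀ x₀≉0 hyp x = ⇔-trans (step-swap (evens (cons x₀ x)) (evens (cons h₀ (cons x₀ x))) x₀≉0 a b m hyp)
    (Ker-⇔ b a m (λ i h → reflexive (≡.sym (evens-mapPairs _ _ m x i h)))
      (λ { zero h → refl ; (suc i) h → reflexive (≡.sym (odds-mapPairs _ _ m x i (ℕ.≤-trans (ℕ.n≤1+n _) h))) }))

  Ker′-0 : ∀ a h₀ x₀ → ¬ (h₀ ≈ 0#) → ∀ x → Ker′ (suc a) 0 (suc a) h₀ (cons x₀ x) ⇔ (x₀ ≈ 0#)
  Ker′-0 a h₀ x₀ h₀≉0 x = mk⇔ to (Ker-p₀≈0 a _ _)
    where
    to : Ker′ (suc a) 0 (suc a) h₀ (cons x₀ x) → x₀ ≈ 0#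
    to k with x₀ ≈? 0#
    ... | yes e = e
    ... | no h  = contradiction (Ker-swap k) (¬Ker-0 (suc a) _ _ h)

  q*Σq : ∀ f n → (∀ a → q ℕ.* f a ≡ n) → q ℕ.* Σq f ≡ q ℕ.* n
  q*Σq f n e = ≡.trans (ℕΣ.*-distribˡ-sum q (f ∘ enum))
    (≡.trans (sum-cong-≗ (e ∘ enum)) (Σq-const n))

  count-zero : ∀ n → Σq (λ a → n ℕ.* indicator (a ≈? 0#)) ≡ n
  count-zero n = ≡.trans (SingleTerm.sum-single ℕ.+-0-commutativeMonoid (index 0#) others) at
    where
    others : ∀ i → i ≢ index 0# → n ℕ.* indicator (enum i ≈? 0#) ≡ 0
    others i i≢0 with enum i ≈? 0#
    ... | yes e = contradiction (enum-inj _ _ (trans e (sym (enum-index 0#)))) i≢0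
    ... | no _  = ℕ.*-zeroʳ n
    at : n ℕ.* indicator (enum (index 0#) ≈? 0#) ≡ n
    at with enum (index 0#) ≈? 0#
    ... | yes _ = ℕ.*-identityʳ n
    ... | no h  = contradiction (enum-index 0#) h

  -- The bound on N makes all coefficients that matter, x₀ up to x with index 2m, free variables.
  -- Leaving `K?` arbitrary lets the induction restrict it to a fibre and use any decision procedure
  -- for the smaller problem.
  count : ∀ a b m N h₀ → ¬ (h₀ ≈ 0#) → suc a ℕ.+ b ≡ suc m → m ℕ.* 2 ℕ.≤ N →
    (K? : ∀ x → Dec (Ker′ (suc a) b (suc m) h₀ x)) →
    q ℕ.* ΣS (suc N) (indicator ∘ K?) ≡ q ^ suc N
  count a zero m N h₀ h₀≉0 eq m≤N K? with ≡.trans (≡.sym (ℕ.+-identityʳ (suc a))) eq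
  -- With β empty the condition is x₀ = 0, met by one value of x₀ and leaving N coefficients free.
  ... | ≡.refl = ≡.cong (q ℕ.*_) (≡.trans (Σq-cong λ x₀ → ≡.trans
    (ΣS-cong N (λ x → indicator-⇔ (K? (cons x₀ x)) (x₀ ≈? 0#) (Ker′-0 a h₀ x₀ h₀≉0 x)))
    (ΣS-const N _)) (count-zero (q ^ N)))
  count a (suc b) zero N h₀ h₀≉0 eq m≤N K? = contradiction (ℕ.suc-injective eq) (ℕ.m+1+n≢0 a)
  count a (suc b) (suc m) (suc N) h₀ h₀≉0 eq (ℕ.s≤s m≤N) K? = q*Σq _ _ fiber
    where
    m≤N′ : m ℕ.* 2 ℕ.≤ N
    m≤N′ = ℕ.≤-trans (ℕ.n≤1+n _) m≤N
    transfer : ∀ a′ b′ h₀′ x₀ τ₁ τ₂ → ¬ (h₀′ ≈ 0#) → (eq′ : suc a′ ℕ.+ b′ ≡ suc m) →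
      Congruent₂ τ₁ → Congruent₂ τ₂ → PreservesSums τ₁ τ₂ →
      (∀ x → Ker′ (suc a) (suc b) (suc (suc m)) h₀ (cons x₀ x) ⇔
             Ker′ (suc a′) b′ (suc m) h₀′ (mapPairs τ₁ τ₂ (suc m) x)) →
      q ℕ.* ΣS (suc N) (λ x → indicator (K? (cons x₀ x))) ≡ q ^ suc N
    transfer a′ b′ h₀′ x₀ τ₁ τ₂ h₀′≉0 eq′ c₁ c₂ pres equiv = ≡.trans (≡.cong (q ℕ.*_) (≡.trans
      (ΣS-cong (suc N) (λ x → indicator-⇔ (K? (cons x₀ x)) (K′? (mapPairs τ₁ τ₂ (suc m) x)) (equiv x)))
      (ΣS-mapPairs τ₁ τ₂ c₁ c₂ pres (suc m) (suc N) (ℕ.s≤s m≤N) (indicator ∘ K′?)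
        (λ {x} {y} e → indicator-⇔ (K′? x) (K′? y) (Ker′-cong (suc a′) b′ (suc m) h₀′ e)))))
      (count a′ b′ m N h₀′ h₀′≉0 eq′ m≤N′ K′?)
      where K′? = ker′? (suc a′) b′ (suc m) h₀′ eq′ h₀′≉0
    eq₁ : suc a ℕ.+ b ≡ suc m
    eq₁ = ℕ.suc-injective (≡.trans (≡.sym (ℕ.+-suc (suc a) b)) eq)
    via₁ : ∀ x₀ → suc a ℕ.≤ suc b ⊎ x₀ ≈ 0# → q ℕ.* ΣS (suc N) (λ x → indicator (K? (cons x₀ x))) ≡ q ^ suc N
    via₁ x₀ hyp = transfer a b h₀ x₀ _ _ h₀≉0 eq₁ (λ e f → +-cong (*-congˡ f) (*-congˡ e)) (λ e f → e)
      (preserves-shear₁ h₀ (- x₀) h₀≉0) (step₁ (suc a) b (suc m) h₀ x₀ h₀≉0 hyp)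
    fiber : ∀ x₀ → q ℕ.* ΣS (suc N) (λ x → indicator (K? (cons x₀ x))) ≡ q ^ suc N
    -- Only in the last case does the pivot change, from h₀ to x₀; the two lengths are exchanged
    -- along with it.
    fiber x₀ with suc a ℕ.≤? suc b | x₀ ≈? 0#
    ... | yes a≤b | _     = via₁ x₀ (inj₁ a≤b)
    ... | no _    | yes e = via₁ x₀ (inj₂ e)
    ... | no a≰b  | no h  = transfer b a x₀ x₀ _ _ h (≡.trans (ℕ.+-comm (suc b) a) (ℕ.suc-injective eq))
      (λ e f → +-cong (*-congˡ e) (*-congˡ f)) (λ e f → f)
      (preserves-shear₂ x₀ (- h₀) h) (step₂ a (suc b) (suc m) h₀ x₀ h (ℕ.<⇒≤ (ℕ.≰⇒> a≰b)))

-- Jacobi–Trudi matrices of staircases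

module _ {a p} {A : Set a} {P : A → Set p} (P? : ∀ x → Dec (P x)) where

  length-filter-∷ : ∀ x xs → length (filter P? (x ∷ xs)) ≡ indicator (P? x) ℕ.+ length (filter P? xs)
  length-filter-∷ x xs with P? x
  ... | yes _ = ≡.refl
  ... | no _  = ≡.refl

  length-filter-concatMap-tabulate : ∀ {b} {B : Set b} (g : B → List A) n (f : Fin n → B) →
    length (filter P? (concatMap g (tabulate f))) ≡ ℕΣ.sum (λ i → length (filter P? (g (f i))))
  length-filter-concatMap-tabulate g zero    f = ≡.refl
  length-filter-concatMap-tabulate g (suc n) f = ≡.trans
    (≡.cong length (filter-++ P? (g (f zero)) _))
    (≡.trans (length-++ (filter P? (g (f zero))))
      (≡.cong (length (filter P? (g (f zero))) ℕ.+_) (length-filter-concatMap-tabulate g n (f ∘ suc))))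

length-filter-map : ∀ {a b p} {A : Set a} {B : Set b} {P : B → Set p} (P? : ∀ y → Dec (P y)) (h : A → B) xs →
  length (filter P? (List.map h xs)) ≡ length (filter (λ x → P? (h x)) xs)
length-filter-map P? h []       = ≡.refl
length-filter-map P? h (x ∷ xs) = ≡.trans (length-filter-∷ P? (h x) (List.map h xs))
  (≡.trans (≡.cong (indicator (P? (h x)) ℕ.+_) (length-filter-map P? h xs))
    (≡.sym (length-filter-∷ (λ x → P? (h x)) x xs)))

length-staircase : ∀ k → length (staircase k) ≡ k
length-staircase zero    = ≡.refl
length-staircase (suc k) = ≡.cong suc (length-staircase k)

lookup-staircase : ∀ k i → lookup (staircase k) i ℕ.+ toℕ i ≡ length (staircase k)
lookup-staircase (suc k) zero    = ≡.trans (ℕ.+-identityʳ (suc k)) (≡.sym (length-staircase (suc k)))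
lookup-staircase (suc k) (suc i) = ≡.trans (ℕ.+-suc _ (toℕ i)) (≡.cong suc (lookup-staircase k i))

opposite-+ : ∀ {n} (i : Fin n) → toℕ (opposite i) ℕ.+ suc (toℕ i) ≡ n
opposite-+ {n} i = ≡.trans (≡.cong (ℕ._+ suc (toℕ i)) (Fin.opposite-prop i)) (ℕ.m∸n+n≡m (Fin.toℕ<n i))

-- For reversed indices i′ and j′ the staircase entry is h with index 2i′ + 1 - j′. Thus the rows,
-- read upwards, extract the coefficients of t, t³, t⁵, ... of a product with H(t).
jacobiTrudi-index : ∀ {n} L (i j : Fin n) → L ℕ.+ toℕ i ≡ n →
  (+ L) ℤ.- (+ toℕ i) ℤ.+ (+ toℕ j) ≡ (toℕ (opposite i) ℕ.+ suc (toℕ (opposite i))) ⊖ toℕ (opposite j)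
jacobiTrudi-index {n} L i j L+i≡n = begin
  (+ L) ℤ.- (+ I) ℤ.+ (+ J)   ≡⟨ ≡.cong (ℤ._+ (+ J)) (ℤ.[+m]-[+n]≡m⊖n L I) ⟩
  (L ⊖ I) ℤ.+ (+ J)           ≡⟨ ℤ.distribˡ-⊖-+-pos J L I ⟩
  (L ℕ.+ J) ⊖ I               ≡⟨ ℤ.+-cancelˡ-⊖ j′ (L ℕ.+ J) I ⟨
  (j′ ℕ.+ (L ℕ.+ J)) ⊖ (j′ ℕ.+ I)  ≡⟨ ≡.cong₂ _⊖_ index-eq (ℕ.+-comm j′ I) ⟩
  (I ℕ.+ (i′ ℕ.+ suc i′)) ⊖ (I ℕ.+ j′) ≡⟨ ℤ.+-cancelˡ-⊖ I (i′ ℕ.+ suc i′) j′ ⟩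
  (i′ ℕ.+ suc i′) ⊖ j′        ∎
  where
  open ≡.≡-Reasoning
  I = toℕ i
  J = toℕ j
  i′ = toℕ (opposite i)
  j′ = toℕ (opposite j)
  L≡ : L ≡ suc i′
  L≡ = ℕ.+-cancelʳ-≡ I L (suc i′) (≡.trans L+i≡n (≡.trans (≡.sym (opposite-+ i)) (ℕ.+-suc i′ I)))
  j′+J : j′ ℕ.+ J ≡ I ℕ.+ i′
  j′+J = ℕ.suc-injective (begin
    suc (j′ ℕ.+ J) ≡⟨ ℕ.+-suc j′ J ⟨
    j′ ℕ.+ suc J   ≡⟨ opposite-+ j ⟩
    n              ≡⟨ opposite-+ i ⟨
    i′ ℕ.+ suc I   ≡⟨ ℕ.+-comm i′ (suc I) ⟩
    suc (I ℕ.+ i′) ∎)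
  index-eq : j′ ℕ.+ (L ℕ.+ J) ≡ I ℕ.+ (i′ ℕ.+ suc i′)
  index-eq = begin
    j′ ℕ.+ (L ℕ.+ J)      ≡⟨ ≡.cong (j′ ℕ.+_) (ℕ.+-comm L J) ⟩
    j′ ℕ.+ (J ℕ.+ L)      ≡⟨ ℕ.+-assoc j′ J L ⟨
    (j′ ℕ.+ J) ℕ.+ L      ≡⟨ ≡.cong₂ ℕ._+_ j′+J L≡ ⟩
    (I ℕ.+ i′) ℕ.+ suc i′ ≡⟨ ℕ.+-assoc I i′ (suc i′) ⟩
    I ℕ.+ (i′ ℕ.+ suc i′) ∎

⌈n/2⌉≤⇒n≤2* : ∀ n i → ⌈ n /2⌉ ≤ i → n ≤ i ℕ.* 2
⌈n/2⌉≤⇒n≤2* zero          i       h         = ℕ.z≤n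
⌈n/2⌉≤⇒n≤2* (suc zero)    (suc i) h         = ℕ.s≤s ℕ.z≤n
⌈n/2⌉≤⇒n≤2* (suc (suc n)) (suc i) (ℕ.s≤s h) = ℕ.s≤s (ℕ.s≤s (⌈n/2⌉≤⇒n≤2* n i h))

module JacobiTrudi {a ℓ : Level} {q : ℕ} (F : FiniteField a ℓ q) where
  open FiniteField F renaming (ring to R)
  open CommutativeRing R hiding (zero)
  open Determinant R
  open FieldTheory F
  open Kernel F
  open Counting F
  open import Algebra.Properties.Semiring.Sum semiring
  open import Relation.Binary.Reasoning.Setoid setoid

  -- The coefficients of α(t²) + t β(t²); the two series exchange roles at each step of the
  -- recursion.
  interleave : Series → Series → Series
  interleave α β zero    = α zero
  interleave α β (suc n) = interleave β (α ∘ suc) n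

  interleave-even : ∀ α β i → interleave α β (i ℕ.* 2) ≡ α i
  interleave-even α β zero    = ≡.refl
  interleave-even α β (suc i) = interleave-even (α ∘ suc) (β ∘ suc) i

  interleave-odd : ∀ α β i → interleave α β (suc (i ℕ.* 2)) ≡ β i
  interleave-odd α β i = interleave-even β (α ∘ suc) i

  interleave-evens : ∀ x n → interleave (evens x) (evens (x ∘ suc)) n ≡ x n
  interleave-evens x zero    = ≡.refl
  interleave-evens x (suc n) = interleave-evens (x ∘ suc) n

  evens-index : ∀ x i → evens x i ≡ x (i ℕ.* 2)
  evens-index x zero    = ≡.refl
  evens-index x (suc i) = evens-index (λ n → x (suc (suc n))) i

  -- The odd part of (α(t²) + t β(t²)) (c(t²) + t p(t²)) is t times α p + β c evaluated at t².
  conv-interleave : ∀ α β c p i →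
    conv (interleave α β) (interleave c p) (suc (i ℕ.* 2)) ≈ conv α p i + conv β c i
  conv-interleave α β c p zero    = refl
  conv-interleave α β c p (suc i) = begin
    α zero * h (suc (suc i ℕ.* 2)) + (β zero * h (suc i ℕ.* 2) + conv (interleave (α ∘ suc) (β ∘ suc)) h (suc (i ℕ.* 2)))
      ≈⟨ +-cong (*-congˡ (reflexive (interleave-odd c p (suc i))))
           (+-cong (*-congˡ (reflexive (interleave-even c p (suc i)))) (conv-interleave (α ∘ suc) (β ∘ suc) c p i)) ⟩
    α zero * p (suc i) + (β zero * c (suc i) + (conv (α ∘ suc) p i + conv (β ∘ suc) c i))
      ≈⟨ solve 4 (λ x y s t → x :+ (y :+ (s :+ t)) := (x :+ s) :+ (y :+ t)) refl _ _ _ _ ⟩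
    conv α p (suc i) + conv β c (suc i) ∎
    where
    h = interleave c p
    open import Algebra.Solver.Ring.NaturalCoefficients.Default commutativeSemiring
      using (solve; _:=_; _:+_)

  interleave-supported : ∀ k {α β} → Supported ⌈ k /2⌉ α → Supported ⌊ k /2⌋ β → Supported k (interleave α β)
  interleave-supported zero    sα sβ zero    _         = sα zero ℕ.z≤n
  interleave-supported zero    sα sβ (suc l) _         = interleave-supported zero sβ (λ i _ → sα (suc i) ℕ.z≤n) l ℕ.z≤n
  interleave-supported (suc k) sα sβ (suc l) (ℕ.s≤s h) =
    interleave-supported k sβ (λ i h → sα (suc i) (ℕ.s≤s h)) l h

  evens-supported : ∀ k {x} → Supported k x → Supported ⌈ k /2⌉ (evens x)
  evens-supported k {x} sx i h = trans (reflexive (evens-index x i)) (sx (i ℕ.* 2) (⌈n/2⌉≤⇒n≤2* k i h))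

  odds-supported : ∀ k {x} → Supported k x → Supported ⌊ k /2⌋ (evens (x ∘ suc))
  odds-supported zero    sx = evens-supported zero (λ i _ → sx (suc i) ℕ.z≤n)
  odds-supported (suc k) sx = evens-supported k (λ i h → sx (suc i) (ℕ.s≤s h))

  interleave-nonzero : ∀ α β l → ¬ (interleave α β l ≈ 0#) → ∃ λ i → ¬ (α i ≈ 0#) ⊎ ¬ (β i ≈ 0#)
  interleave-nonzero α β zero    h = zero , inj₁ h
  interleave-nonzero α β (suc l) h with interleave-nonzero β (α ∘ suc) l h
  ... | i , inj₁ g = i , inj₂ g
  ... | i , inj₂ g = suc i , inj₁ g

  -- The coefficient h (m - l), read as 0# when l > m.
  lagged : Series → ℕ → ℕ → Carrier
  lagged h m       zero    = h m
  lagged h zero    (suc l) = 0#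
  lagged h (suc m) (suc l) = lagged h m l

  hImg-⊖ : ∀ x m l → hImg R x (m ⊖ l) ≡ lagged (cons 1# x) m l
  hImg-⊖ x zero    zero    = ≡.refl
  hImg-⊖ x (suc m) zero    = ≡.refl
  hImg-⊖ x zero    (suc l) = ≡.refl
  hImg-⊖ x (suc m) (suc l) = ≡.trans (≡.cong (hImg R x) (ℤ.[1+m]⊖[1+n]≡m⊖n m l)) (hImg-⊖ x m l)

  conv-lagged : ∀ n U h m → Supported n U → conv U h m ≈ sum (λ (j : Fin n) → U (toℕ j) * lagged h m (toℕ j))
  conv-lagged zero    U h m       sU = conv-0ˡ m h (λ j → sU j ℕ.z≤n)
  conv-lagged (suc n) U h zero    sU = trans (sym (+-identityʳ _))
    (+-congˡ (sym (trans (sum-cong-≋ {n} (λ j → zeroʳ (U (suc (toℕ j))))) (sum-replicate-zero n))))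
  conv-lagged (suc n) U h (suc m) sU = +-congˡ (conv-lagged n (U ∘ suc) h m (λ i h → sU (suc i) (ℕ.s≤s h)))

  pad : ∀ {n} → (Fin n → Carrier) → Series
  pad {zero}  v = λ _ → 0#
  pad {suc n} v = cons (v zero) (pad (v ∘ suc))

  pad-toℕ : ∀ {n} (v : Fin n → Carrier) j → pad v (toℕ j) ≡ v j
  pad-toℕ v zero    = ≡.refl
  pad-toℕ v (suc j) = pad-toℕ (v ∘ suc) j

  pad-supported : ∀ {n} (v : Fin n → Carrier) → Supported n (pad v)
  pad-supported {zero}  v i       _         = refl
  pad-supported {suc n} v (suc i) (ℕ.s≤s h) = pad-supported (v ∘ suc) i h

  module StaircaseMatrix (k : ℕ) (x : Series) where
    n : ℕ
    n = length (staircase k)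

    M : Mat n
    M i j = hImg R x ((+ lookup (staircase k) i) ℤ.- (+ toℕ i) ℤ.+ (+ toℕ j))

    h p c : Series
    h = cons 1# x
    p = evens x
    c = evens h

    entry : ∀ i j → M i j ≡ lagged h (suc (toℕ (opposite i) ℕ.* 2)) (toℕ (opposite j))
    entry i j = ≡.trans (≡.cong (hImg R x) (jacobiTrudi-index _ i j (lookup-staircase k i)))
      (≡.trans (hImg-⊖ x _ (toℕ (opposite j))) (≡.cong (λ m → lagged h m (toℕ (opposite j))) (odd≡ (toℕ (opposite i)))))
      where
      odd≡ : ∀ i → i ℕ.+ suc i ≡ suc (i ℕ.* 2)
      odd≡ i = ≡.trans (ℕ.+-suc i i) (≡.cong suc (≡.trans (≡.cong (i ℕ.+_) (≡.sym (ℕ.+-identityʳ i))) (ℕ.*-comm 2 i)))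

    -- Column j carries the coefficient of U at the reversed index, so reversing the sum turns the
    -- row product into an odd coefficient of U(t) H(t).
    dot-row : ∀ U → Supported n U → ∀ i →
      dot (λ j → U (toℕ (opposite j))) (M i) ≈
      conv (evens U) p (toℕ (opposite i)) + conv (evens (U ∘ suc)) c (toℕ (opposite i))
    dot-row U sU i = begin
      sum (λ (j : Fin n) → U (toℕ (opposite j)) * M i j)
        ≈⟨ sum-cong-≋ (λ j → *-congˡ (reflexive (entry i j))) ⟩
      sum (λ (j : Fin n) → U (toℕ (opposite j)) * lagged h m (toℕ (opposite j)))
        ≈⟨ sum-permute (λ j → U (toℕ j) * lagged h m (toℕ j)) (Perm.reverse {n}) ⟨
      sum (λ (j : Fin n) → U (toℕ j) * lagged h m (toℕ j))
        ≈⟨ conv-lagged n U h m sU ⟨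
      conv U h m
        ≈⟨ conv-cong m (λ j → reflexive (≡.sym (interleave-evens U j))) (λ j _ → reflexive (≡.sym (interleave-evens h j))) ⟩
      conv (interleave (evens U) (evens (U ∘ suc))) (interleave c p) m
        ≈⟨ conv-interleave (evens U) (evens (U ∘ suc)) c p (toℕ (opposite i)) ⟩
      conv (evens U) p (toℕ (opposite i)) + conv (evens (U ∘ suc)) c (toℕ (opposite i)) ∎
      where m = suc (toℕ (opposite i) ℕ.* 2)

    null⇒Ker : NullVector M → Ker ⌈ n /2⌉ ⌊ n /2⌋ n p c
    null⇒Ker (v , (j₀ , nz) , v⊥) = evens U , evens (U ∘ suc) , evens-supported n sU , odds-supported n sU ,
        interleave-nonzero _ _ (toℕ (opposite j₀)) (λ e → nz (begin
          v j₀                    ≡⟨ U≡v j₀ ⟨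
          U (toℕ (opposite j₀))   ≡⟨ interleave-evens U _ ⟨
          interleave (evens U) (evens (U ∘ suc)) (toℕ (opposite j₀)) ≈⟨ e ⟩
          0#                      ∎)) ,
        eqn
      where
      U : Series
      U = pad (v ∘ opposite)
      sU : Supported n U
      sU = pad-supported (v ∘ opposite)
      U≡v : ∀ j → U (toℕ (opposite j)) ≡ v j
      U≡v j = ≡.trans (pad-toℕ (v ∘ opposite) (opposite j)) (≡.cong v (Fin.opposite-involutive j))
      row : ∀ i → conv (evens U) p (toℕ (opposite i)) + conv (evens (U ∘ suc)) c (toℕ (opposite i)) ≈ 0#
      row i = trans (sym (dot-row U sU i)) (trans (sum-cong-≋ {n} (λ j → *-congʳ (reflexive (U≡v j)))) (v⊥ i))
      eqn : ∀ i → i ℕ.< n → conv (evens U) p i + conv (evens (U ∘ suc)) c i ≈ 0#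
      eqn i i<n = ≡.subst (λ t → conv (evens U) p t + conv (evens (U ∘ suc)) c t ≈ 0#)
        (≡.trans (≡.cong toℕ (Fin.opposite-involutive (fromℕ< i<n))) (Fin.toℕ-fromℕ< i<n)) (row (opposite (fromℕ< i<n)))

    Ker⇒null : Ker ⌈ n /2⌉ ⌊ n /2⌋ n p c → NullVector M
    Ker⇒null (α , β , sα , sβ , (i₀ , nz) , eqn) = (λ j → U (toℕ (opposite j))) , nonzero nz , λ i → begin
        dot (λ j → U (toℕ (opposite j))) (M i) ≈⟨ dot-row U sU i ⟩
        conv (evens U) p (toℕ (opposite i)) + conv (evens (U ∘ suc)) c (toℕ (opposite i))
          ≈⟨ +-cong (conv-cong (toℕ (opposite i)) evens≈ (λ _ _ → refl))
               (conv-cong (toℕ (opposite i)) odds≈ (λ _ _ → refl)) ⟩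
        conv α p (toℕ (opposite i)) + conv β c (toℕ (opposite i)) ≈⟨ eqn _ (Fin.toℕ<n (opposite i)) ⟩
        0# ∎
      where
      U : Series
      U = interleave α β
      sU : Supported n U
      sU = interleave-supported n sα sβ
      evens≈ : ∀ i → evens U i ≈ α i
      evens≈ i = reflexive (≡.trans (evens-index U i) (interleave-even α β i))
      odds≈ : ∀ i → evens (U ∘ suc) i ≈ β i
      odds≈ i = reflexive (≡.trans (evens-index (U ∘ suc) i) (interleave-odd α β i))
      at : ∀ l → ¬ (U l ≈ 0#) → Nonzero {n} (λ j → U (toℕ (opposite j)))
      at l Ul≉0 with ℕ.<-≤-connex l n
      ... | inj₂ n≤l = contradiction (sU l n≤l) Ul≉0
      ... | inj₁ l<n = opposite (fromℕ< l<n) , λ e → Ul≉0 (trans (reflexive (≡.cong U (≡.sym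
              (≡.trans (≡.cong toℕ (Fin.opposite-involutive (fromℕ< l<n))) (Fin.toℕ-fromℕ< l<n))))) e)
      nonzero : ¬ (α i₀ ≈ 0#) ⊎ ¬ (β i₀ ≈ 0#) → Nonzero {n} (λ j → U (toℕ (opposite j)))
      nonzero (inj₁ g) = at (i₀ ℕ.* 2) (λ e → g (trans (reflexive (≡.sym (interleave-even α β i₀))) e))
      nonzero (inj₂ g) = at (suc (i₀ ℕ.* 2)) (λ e → g (trans (reflexive (≡.sym (interleave-odd α β i₀))) e))

  schurImg-staircase : ∀ k x → (schurImg R (staircase k) x ≈ 0#) ⇔ Ker′ ⌈ k /2⌉ ⌊ k /2⌋ k 1# x
  -- The matrix has size `length (staircase k)`, which equals k only propositionally.
  schurImg-staircase k x = ≡.subst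
    (λ m → (schurImg R (staircase k) x ≈ 0#) ⇔ Ker′ ⌈ m /2⌉ ⌊ m /2⌋ m 1# x) (length-staircase k)
    (mk⇔ (null⇒Ker ∘ det≈0⇒null M) (null⇒det≈0 M ∘ Ker⇒null))
    where open StaircaseMatrix k x

  -- From tuples of values to sums over series

  hImg-cong : ∀ {x y} → (∀ n → x n ≈ y n) → ∀ z → hImg R x z ≈ hImg R y z
  hImg-cong e -[1+ _ ]    = refl
  hImg-cong e (+ zero)    = refl
  hImg-cong e (+ (suc n)) = e n

  schurImg-cong : ∀ λs {x y} → (∀ n → x n ≈ y n) → schurImg R λs x ≈ schurImg R λs y
  schurImg-cong λs e = det-cong {length λs} (λ i j → hImg-cong e ((+ lookup λs i) ℤ.- (+ toℕ i) ℤ.+ (+ toℕ j)))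

  embed : ∀ {N} → (Fin N → Fin q) → Series
  embed t = pad (enum ∘ t)

  -- The comparison inside `assign` is traded for structural recursion, under which extending a
  -- tuple at the front is `cons`.
  assign≡embed : ∀ N t n → assign F N t n ≡ embed t n
  assign≡embed N t n with n ℕ.<? N
  ... | yes n<N = within N t n n<N
    where
    within : ∀ N (t : Fin N → Fin q) n (n<N : n ℕ.< N) → enum (t (fromℕ< n<N)) ≡ embed t n
    within (suc N) t zero    n<N = ≡.refl
    within (suc N) t (suc n) n<N = within N (t ∘ suc) n (ℕ.s<s⁻¹ n<N)
  ... | no n≮N  = beyond N t n (ℕ.≮⇒≥ n≮N)
    where
    beyond : ∀ N (t : Fin N → Fin q) n → N ≤ n → 0# ≡ embed t n
    beyond zero    t n       _         = ≡.refl
    beyond (suc N) t (suc n) (ℕ.s≤s h) = beyond N (t ∘ suc) n h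

  -- Comparing the predicate with φ through `embed` avoids any equality of tuples as functions: the
  -- extended tuple embeds definitionally as a `cons`.
  count-allTuples : ∀ {r} N {P : (Fin N → Fin q) → Set r} (P? : ∀ t → Dec (P t)) (φ : Series → ℕ) →
    (∀ t → indicator (P? t) ≡ φ (embed t)) → length (filter P? (allTuples q N)) ≡ ΣS N φ
  count-allTuples zero    P? φ e = ≡.trans (length-filter-∷ P? _ []) (≡.trans (ℕ.+-identityʳ _) (e _))
  count-allTuples (suc N) P? φ e = ≡.trans
    (length-filter-concatMap-tabulate P? _ q id)
    (ℕΣ.sum-cong-≗ (λ i → ≡.trans (length-filter-map P? _ (allTuples q N))
      (count-allTuples N _ (φ ∘ cons (enum i)) (λ t → e _))))

  zeroCount≡ΣS : ∀ λs N → zeroCount F λs N ≡ ΣS N (λ x → indicator (schurImg R λs x ≈? 0#))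
  zeroCount≡ΣS λs N = count-allTuples N (λ t → schurImg R λs (assign F N t) ≈? 0#) _
    (λ t → indicator-⇔ (schurImg R λs (assign F N t) ≈? 0#) (schurImg R λs (embed t) ≈? 0#)
      (≈⇒⇔ (schurImg-cong λs (λ n → reflexive (assign≡embed N t n)))))
    where
    ≈⇒⇔ : ∀ {a b} → a ≈ b → (a ≈ 0#) ⇔ (b ≈ 0#)
    ≈⇒⇔ e = mk⇔ (trans (sym e)) (trans e)

-- The probability that a staircase Schur function vanishes

open import Data.Nat using (_*_; _∸_)

theorem6p5 : {c ℓ : Level} (q : ℕ) → IsPrimePower q → (F : FiniteField c ℓ q) →
    (k : ℕ) → 1 ≤ k → (N : ℕ) → (2 * k ∸ 1) ≤ N →
    q * zeroCount F (staircase k) N ≡ q ^ N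
theorem6p5 q _ F (suc k) _ zero h = contradiction (≡.subst (_≤ 0) (ℕ.+-suc k (k ℕ.+ 0)) h) (λ ())
theorem6p5 q _ F (suc k) _ (suc N) h = ≡.trans
  (≡.cong (q *_) (≡.trans (zeroCount≡ΣS (staircase (suc k)) (suc N))
    (ΣS-cong (suc N) (λ x → indicator-⇔ (schurImg R (staircase (suc k)) x ≈? 0#) (K? x) (schurImg-staircase (suc k) x)))))
  -- For the staircase of size k + 1 the lengths ⌈(k+1)/2⌉ and ⌊(k+1)/2⌋ unfold to 1 + ⌊k/2⌋ and
  -- ⌈k/2⌉, and the initial pivot is h₀ = 1.
  (count ⌊ k /2⌋ ⌈ k /2⌉ k N 1# 1≉0 (≡.cong suc (ℕ.⌊n/2⌋+⌈n/2⌉≡n k)) 2k≤N K?)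
  where
  open FiniteField F renaming (ring to R)
  open CommutativeRing R using (0#; 1#)
  open JacobiTrudi F
  open Counting F
  K? : ∀ x → Dec (Ker′ (suc ⌊ k /2⌋) ⌈ k /2⌉ (suc k) 1# x)
  K? = ker′? (suc ⌊ k /2⌋) ⌈ k /2⌉ (suc k) 1# (≡.cong suc (ℕ.⌊n/2⌋+⌈n/2⌉≡n k)) 1≉0
  2k≤N : k * 2 ≤ N
  2k≤N = ℕ.≤-pred (≡.subst (_≤ suc N) (≡.trans (ℕ.+-suc k (k ℕ.+ 0)) (≡.cong suc (ℕ.*-comm 2 k))) h)
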